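{- Let $n$ be an absolute Lucas pseudoprime to the discriminant $d$ of the form $n=Pqr$ with $q$ and $r$ primes, $q<r$, and $P>1$ an integer all of whose prime factors are less than $q$. Let $p$ be the largest prime dividing $P$. Then there are integers $1\le D<P<C$ such that, with $\Delta=CD-P^2$, \[ q-\delta_q=\frac{(P-\delta_P)(\delta_qP+\delta_rD)}{\Delta},\qquad r-\delta_r=\frac{(P-\delta_P)(\delta_rP+\delta_qC)}{\Delta},\] and \[ \frac{(p-1)P^2-2P}{p+1}<CD<\frac{(p+3)P^2+2P}{p+1}.\]
   Context: Fix an integer $d$ of the form $d=a^2-4b$ with $a>0$, $b$ coprime integers. For integers $a,b$ the Lucas sequence is $U_0(a,b)=0$, $U_1(a,b)=1$, $U_m(a,b)=aU_{m-1}(a,b)-bU_{m-2}(a,b)$. For an odd positive integer $m$, $\delta_m$ denotes the Jacobi symbol $\left(\frac{d}{m}\right)$. An absolute Lucas pseudoprime to the discriminant $d$ is an odd composite integer $n$ with $\gcd(n,d)=1$ such that $U_{n-\delta_n}(a,b)\equiv 0\pmod n$ for all integers $a,b$ with $d=a^2-4b$ and $\gcd(n,db)=1$. -}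

module Defs where

open import Data.Bool using (Bool; true; false; if_then_else_)
open import Data.Nat as ℕ using (ℕ; zero; suc)
import Data.Nat.DivMod as ℕD
open import Data.Nat.Divisibility using (_∣?_)
open import Data.Nat.GCD using (gcd)
open import Data.Nat.Primality using (Composite)
open import Data.Integer as ℤ using (ℤ; +_; ∣_∣)
open import Data.Integer.DivMod using (_%ℕ_)
import Data.Integer.Divisibility as ℤDiv
open import Data.List using (List; upTo)
open import Data.Bool.ListAction using (any)
open import Data.Product using (Σ; ∃; _×_; _,_)
open import Relation.Nullary.Decidable using (⌊_⌋)
open import Relation.Binary.PropositionalEquality using (_≡_)

U : ℤ → ℤ → ℕ → ℤ
U a b zero = + 0
U a b (suc zero) = + 1
U a b (suc (suc m)) = a ℤ.* U a b (suc m) ℤ.- b ℤ.* U a b m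

-- Legendre symbol (d / p) for the prime 2+j (given as j), by definition:
-- 0 if p ∣ d, 1 if d is a nonzero square mod p, -1 otherwise.
legendre₂₊ : ℤ → ℕ → ℤ
legendre₂₊ d j with d %ℕ suc (suc j)
... | zero = + 0
... | rd@(suc _) =
  if any (λ x → ⌊ (x ℕ.* x) ℕD.% suc (suc j) ℕ.≟ rd ⌋) (upTo (suc (suc j)))
  then + 1 else ℤ.-[1+ 0 ]

-- Jacobi symbol by trial-division factorisation of m:
-- (d / m) = product over the prime factors p of m (with multiplicity) of (d / p).
-- jacAux fuel j d m : factor m using candidate divisors 2+j, 3+j, ...
jacAux : ℕ → ℕ → ℤ → ℕ → ℤ
jacAux zero j d m = + 1
jacAux (suc f) j d zero = + 1
jacAux (suc f) j d (suc zero) = + 1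
jacAux (suc f) j d m@(suc (suc _)) =
  if ⌊ suc (suc j) ∣? m ⌋
  then legendre₂₊ d j ℤ.* jacAux f j d (m ℕD./ suc (suc j))
  else jacAux f (suc j) d m

-- Jacobi symbol (d / m) (meaningful for odd positive m); fuel 2m suffices.
jacobi : ℤ → ℕ → ℤ
jacobi d m = jacAux (m ℕ.+ m) 0 d m

δ : ℤ → ℕ → ℤ
δ d m = jacobi d m

idx : ℤ → ℕ → ℕ
idx d n = ∣ + n ℤ.- δ d n ∣

Odd : ℕ → Set
Odd n = n ℕD.% 2 ≡ 1

AbsLucasPsp : ℤ → ℕ → Set
AbsLucasPsp d n =
  Odd n × Composite n × gcd n ∣ d ∣ ≡ 1 ×
  (∀ (a b : ℤ) → d ≡ a ℤ.* a ℤ.- + 4 ℤ.* b → gcd n ∣ d ℤ.* b ∣ ≡ 1 →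
     (+ n) ℤDiv.∣ U a b (idx d n))

AdmissibleDisc : ℤ → Set
AdmissibleDisc d = ∃ λ a → ∃ λ b →
  ℤ.+0 ℤ.< a × gcd ∣ a ∣ ∣ b ∣ ≡ 1 × d ≡ a ℤ.* a ℤ.- + 4 ℤ.* b

{-# OPTIONS --safe #-}

-- Once q - δ_q and r - δ_r divide n - δ_n,
-- the integers C = (P r - δ_P δ_r) / (q - δ_q) and D = (P q - δ_P δ_q) / (r - δ_r)
-- satisfy the two identities, and the bounds on C D follow from
-- Δ (q - δ_q) = (P - δ_P) (δ_q P + δ_r D) and p + 1 ≤ q - δ_q.
--
-- For the divisibility, let (t + √d)^m = A_m(t) + B_m(t) √d in ℤ[√d].  Then
-- 2^m U_m(a, b) = 2 B_m(a), and by the Chinese remainder theorem every residue t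
-- with t² ≢ d (mod q) is represented by an admissible a, so q ∣ B_N(t) for all these t,
-- where N = n - δ_n.  By Frobenius q ∣ B_L(t) for L = q - δ_q, hence also q ∣ B_m(t) for
-- m = N mod L.  No element of order L has to be exhibited: as a polynomial in t, B_m has
-- degree m - 1 and leading coefficient m, so for 0 < m < L it has too few roots modulo q.
-- The root count is done with iterated differences, which turn a polynomial of
-- degree e with leading coefficient c into the constant e! c.

module Submission where

open import Defs
open import Algebra.Bundles using (CommutativeSemiring)
import Algebra.Properties.Semiring.Exp
import Algebra.Properties.Semiring.Mult
open import Data.Bool using (true; false; T)
open import Data.Bool.ListAction using (any)
open import Data.Bool.Properties using (T-≡)
open import Data.Empty using (⊥; ⊥-elim)
open import Data.Fin as Fin using (Fin; toℕ; inject₁; fromℕ)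
import Data.Fin.Properties as Fin
open import Data.Integer as ℤ using (ℤ; +_; -[1+_])
import Data.Integer.Divisibility as ℤᵤ
open import Data.Integer.Divisibility.Signed renaming (_∣_ to _∣ᶻ_)
open import Data.Integer.DivMod using (_%ℕ_; _/ℕ_; n%ℕd<d; a≡a%ℕn+[a/ℕn]*n)
import Data.Integer.Properties as ℤ
open import Data.Integer.Tactic.RingSolver using (solve-∀)
open import Data.List using (List; []; _∷_; _++_; foldr; map; upTo)
open import Data.List.Membership.Propositional using (_∈_; lose; find)
open import Data.List.Membership.Propositional.Properties using (∈-upTo⁺)
open import Data.List.Relation.Binary.Permutation.Propositional using (_↭_; ↭⇒↭ₛ)
import Data.List.Relation.Binary.Permutation.Propositional.Properties as ↭
open import Data.List.Relation.Binary.Permutation.Setoid.Properties using (foldr-commMonoid)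
open import Data.List.Relation.Unary.All using (All; []; _∷_)
import Data.List.Relation.Unary.All.Properties as All
open import Data.List.Relation.Unary.Any using (here; there)
import Data.List.Relation.Unary.Any.Properties as Any
open import Data.Nat as ℕ using (ℕ; zero; suc; _!; _∸_; z≤n; s≤s)
open import Data.Nat.Combinatorics
  using (nCn≡1; nCk≡n!/k![n-k]!; k![n∸k]!∣n!) renaming (_C_ to _choose_)
open import Data.Nat.Coprimality using (Coprime; coprime-Bézout; gcd≡1⇒coprime)
open import Data.Nat.Divisibility using (_∣_)
import Data.Nat.Divisibility as ℕ
open import Data.Nat.DivMod using (_%_; _/_; m≡m%n+[m/n]*n; m%n<n; m/n*n≡m; m/n<m)
open import Data.Nat.GCD using (gcd; gcd[m,n]∣m; gcd[m,n]∣n; gcd[m,n]≢0; module Bézout)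
open import Data.Nat.ListAction using (product)
open import Data.Nat.ListAction.Properties using (product-++; ∈⇒∣product)
open import Data.Nat.Primality using
  (Prime; _Rough_; euclidsLemma; ¬prime[0]; ¬prime[1]; prime[2]; prime⇒nonZero; prime⇒irreducible;
   2-rough; rough⇒≤; ∤⇒rough-suc; rough∧∣⇒rough; rough∧∣⇒prime)
open import Data.Nat.Primality.Factorisation using (PrimeFactorisation; factorise; factorisationUnique)
import Data.Nat.Properties as ℕ
open import Data.Product using (∃; _×_; _,_; proj₁; proj₂)
open import Data.Sum as Sum using (_⊎_; inj₁; inj₂; [_,_]′)
open import Function using (_∘_; id)
open import Function.Bundles using (Equivalence)
open import Level using (0ℓ)
open import Relation.Binary.PropositionalEquality as ≡ using (_≡_; _≢_)
open import Relation.Nullary using (¬_; contradiction; yes; no)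
open import Relation.Nullary.Decidable using (⌊_⌋; toWitness; fromWitness)

-- Binomial coefficients modulo a prime and the Frobenius congruence.

prime∤! : ∀ {p} → Prime p → ∀ n → n ℕ.< p → p ℕ.∤ n !
prime∤! p-prime zero _ p∣1 = ¬prime[1] (≡.subst Prime (ℕ.∣1⇒≡1 p∣1) p-prime)
prime∤! p-prime (suc n) n<p p∣n! with euclidsLemma (suc n) (n !) p-prime p∣n!
... | inj₁ p∣n = ℕ.<⇒≱ n<p (ℕ.∣⇒≤ p∣n)
... | inj₂ p∣n! = prime∤! p-prime n (ℕ.<-trans (ℕ.n<1+n n) n<p) p∣n!

-- The prime divides `p !`, which is the binomial coefficient times `k ! * (p - k) !`; both of these
-- factorials involve only numbers below `p`.
prime∣choose : ∀ {p} → Prime p → ∀ k → k ≢ 0 → k ℕ.< p → p ∣ p choose k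
prime∣choose {p} p-prime k k≢0 k<p = [ id , ⊥-elim ∘ p∤ ]′ (euclidsLemma (p choose k) _ p-prime p∣)
  where
  instance _ = k ℕ.!* (p ∸ k) !≢0
  k≤p = ℕ.<⇒≤ k<p
  p!≡ : (p choose k) ℕ.* (k ! ℕ.* (p ∸ k) !) ≡ p !
  p!≡ = ≡.trans (≡.cong (ℕ._* (k ! ℕ.* (p ∸ k) !)) (nCk≡n!/k![n-k]! k≤p)) (m/n*n≡m (k![n∸k]!∣n! k≤p))
  n∣n! : ∀ {n} → n ≢ 0 → n ∣ n !
  n∣n! {zero} n≢0 = contradiction ≡.refl n≢0
  n∣n! {suc n} _ = ℕ.m∣m*n (n !)
  p∣ : p ∣ (p choose k) ℕ.* (k ! ℕ.* (p ∸ k) !)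
  p∣ = ≡.subst (p ∣_) (≡.sym p!≡) (n∣n! λ { ≡.refl → ¬prime[0] p-prime })
  p∤ : p ℕ.∤ k ! ℕ.* (p ∸ k) !
  p∤ = [ prime∤! p-prime k k<p
       , prime∤! p-prime (p ∸ k) (ℕ.∸-monoʳ-< (ℕ.n≢0⇒n>0 k≢0) k≤p) ]′
       ∘ euclidsLemma (k !) _ p-prime

module Frobenius {c ℓ} (R : CommutativeSemiring c ℓ) where

  open CommutativeSemiring R
  open import Algebra.Properties.Semiring.Exp semiring using (_^_; ^-congʳ)
  open import Algebra.Properties.Semiring.Mult semiring renaming (_×_ to _·_)
  open import Algebra.Properties.CommutativeMonoid.Mult +-commutativeMonoid using (×-distrib-+)
  open import Algebra.Properties.Semiring.Sum semiring using (sum; sum-init-last)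
  open import Algebra.Properties.CommutativeSemiring.Binomial R
    using (binomialTerm) renaming (theorem to binomial-theorem)
  open import Relation.Binary.Reasoning.Setoid setoid

  sum-∣ : ∀ m {n} (f : Fin n → Carrier) → (∀ i → ∃ λ z → f i ≈ m · z) → ∃ λ z → sum f ≈ m · z
  sum-∣ m {zero} f m∣f = 0# , sym (begin
    m · 0#           ≈⟨ ×-congʳ m (zeroˡ 0#) ⟨
    m · (0# * 0#)    ≈⟨ ×-comm-* m 0# 0# ⟨
    0# * (m · 0#)    ≈⟨ zeroˡ _ ⟩
    0#               ∎)
  sum-∣ m {suc n} f m∣f with m∣f Fin.zero | sum-∣ m (f ∘ Fin.suc) (m∣f ∘ Fin.suc)
  ... | z , f0≈ | w , fs≈ = z + w , trans (+-cong f0≈ fs≈) (sym (×-distrib-+ z w m))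

  -- In the binomial expansion every inner coefficient is a multiple of `p`. Working in any
  -- commutative semiring lets one proof serve both ℤ, for Fermat's theorem, and ℤ[√d].
  frobenius : ∀ {p} → Prime p → ∀ x y → ∃ λ z → (x + y) ^ p ≈ x ^ p + y ^ p + p · z
  frobenius {zero} p-prime = contradiction p-prime ¬prime[0]
  frobenius {suc n} p-prime x y with sum-∣ (suc n) (middle ∘ inject₁) middle-∣
    where
    middle : Fin (suc n) → Carrier
    middle = binomialTerm x y (suc n) ∘ Fin.suc
    -- `Fin.suc` has dropped the term y^p and `inject₁` drops x^p, so the exponents of x run from 1
    -- to p - 1.
    middle-∣ : ∀ i → ∃ λ z → middle (inject₁ i) ≈ suc n · z
    middle-∣ i with prime∣choose p-prime (suc (toℕ (inject₁ i))) (λ ())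
                     (s≤s (≡.subst (ℕ._< n) (≡.sym (Fin.toℕ-inject₁ i)) (Fin.toℕ<n i)))
    ... | ℕ.divides k C≡ = k · w , trans (×-cong (≡.trans C≡ (ℕ.*-comm k (suc n))) refl)
                                        (sym (×-assocˡ w (suc n) k))
      where w = x ^ suc (toℕ (inject₁ i)) * y ^ (suc n ∸ suc (toℕ (inject₁ i)))
  ... | z , middle≈ = z , (begin
    (x + y) ^ suc n                  ≈⟨ binomial-theorem (suc n) x y ⟩
    binomialTerm x y (suc n) Fin.zero + sum (binomialTerm x y (suc n) ∘ Fin.suc)
                                      ≈⟨ +-cong head≈ (sum-init-last (binomialTerm x y (suc n) ∘ Fin.suc)) ⟩
    y ^ suc n + (sum (binomialTerm x y (suc n) ∘ Fin.suc ∘ inject₁)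
                  + binomialTerm x y (suc n) (Fin.suc (fromℕ n)))
                                      ≈⟨ +-congˡ (+-cong middle≈ last≈) ⟩
    y ^ suc n + (suc n · z + x ^ suc n)   ≈⟨ +-comm _ _ ⟩
    suc n · z + x ^ suc n + y ^ suc n     ≈⟨ +-assoc _ _ _ ⟩
    suc n · z + (x ^ suc n + y ^ suc n)   ≈⟨ +-comm _ _ ⟩
    x ^ suc n + y ^ suc n + suc n · z     ∎)
    where
    head≈ : binomialTerm x y (suc n) Fin.zero ≈ y ^ suc n
    head≈ = begin
      (suc n choose 0) · (1# * y ^ suc n)  ≈⟨ ×-cong (≡.refl {x = 1}) (*-identityˡ _) ⟩
      1 · (y ^ suc n)                 ≈⟨ ×-homo-1 _ ⟩
      y ^ suc n                       ∎
    last≈ : binomialTerm x y (suc n) (Fin.suc (fromℕ n)) ≈ x ^ suc n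
    last≈ = begin
      (suc n choose toℕ (fromℕ (suc n))) · (x ^ toℕ (fromℕ (suc n)) * y ^ (n ∸ toℕ (fromℕ n)))
        ≈⟨ ×-cong (≡.trans (≡.cong (suc n choose_) (Fin.toℕ-fromℕ (suc n))) (nCn≡1 (suc n)))
             (*-cong (^-congʳ x (Fin.toℕ-fromℕ (suc n)))
                     (^-congʳ y (≡.trans (≡.cong (n ∸_) (Fin.toℕ-fromℕ n)) (ℕ.n∸n≡0 n)))) ⟩
      1 · (x ^ suc n * 1#)   ≈⟨ ×-homo-1 _ ⟩
      x ^ suc n * 1#         ≈⟨ *-identityʳ _ ⟩
      x ^ suc n              ∎

-- Powers in ℤ[√d] and their relation to the Lucas sequence.

open import Data.Integer using (_+_; _-_; _*_; -_; _^_)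
open import Relation.Binary.PropositionalEquality using
  (refl; sym; trans; cong; cong₂; subst; subst₂; setoid; isEquivalence; module ≡-Reasoning)

-- The pair (u , v) stands for u + v√d.
quadratic : ℤ → CommutativeSemiring 0ℓ 0ℓ
quadratic d = record
  { Carrier = ℤ × ℤ
  ; _≈_ = _≡_
  ; _+_ = λ (a , b) (a′ , b′) → a + a′ , b + b′
  ; _*_ = λ (a , b) (a′ , b′) → a * a′ + d * (b * b′) , a * b′ + b * a′
  ; 0# = + 0 , + 0
  ; 1# = + 1 , + 0
  ; isCommutativeSemiring = record
    { isSemiring = record
      { isSemiringWithoutAnnihilatingZero = record
        { +-isCommutativeMonoid = record
          { isMonoid = record
            { isSemigroup = record
              { isMagma = record { isEquivalence = isEquivalence ; ∙-cong = cong₂ _ }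
              ; assoc = λ (a , b) (a′ , b′) (a″ , b″) → cong₂ _,_ (+a a a′ a″) (+a b b′ b″)
              }
            ; identity = (λ (a , b) → cong₂ _,_ (0+ a) (0+ b)) , (λ (a , b) → cong₂ _,_ (+0 a) (+0 b))
            }
          ; comm = λ (a , b) (a′ , b′) → cong₂ _,_ (+c a a′) (+c b b′)
          }
        ; *-cong = cong₂ _
        ; *-assoc = λ (a , b) (a′ , b′) (a″ , b″) → cong₂ _,_
                      (*a₁ d a b a′ b′ a″ b″) (*a₂ d a b a′ b′ a″ b″)
        ; *-identity = (λ (a , b) → cong₂ _,_ (1*₁ d a b) (1*₂ a b))
                     , (λ (a , b) → cong₂ _,_ (*1₁ d a b) (*1₂ a b))
        ; distrib = (λ (a , b) (a′ , b′) (a″ , b″) → cong₂ _,_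
                      (dˡ₁ d a b a′ b′ a″ b″) (dˡ₂ a b a′ b′ a″ b″))
                  , (λ (a , b) (a′ , b′) (a″ , b″) → cong₂ _,_
                      (dʳ₁ d a b a′ b′ a″ b″) (dʳ₂ a b a′ b′ a″ b″))
        }
      ; zero = (λ (a , b) → cong₂ _,_ (0*₁ d a b) (0*₂ a b))
             , (λ (a , b) → cong₂ _,_ (*0₁ d a b) (*0₂ a b))
      }
    ; *-comm = λ (a , b) (a′ , b′) → cong₂ _,_ (*c₁ d a b a′ b′) (*c₂ a b a′ b′)
    }
  }
  where
  +a : ∀ x y z → (x + y) + z ≡ x + (y + z)
  +a = solve-∀
  0+ : ∀ x → + 0 + x ≡ x
  0+ = solve-∀
  +0 : ∀ x → x + + 0 ≡ x
  +0 = solve-∀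
  +c : ∀ x y → x + y ≡ y + x
  +c = solve-∀
  *a₁ : ∀ d a b a′ b′ a″ b″ →
        (a * a′ + d * (b * b′)) * a″ + d * ((a * b′ + b * a′) * b″) ≡
        a * (a′ * a″ + d * (b′ * b″)) + d * (b * (a′ * b″ + b′ * a″))
  *a₁ = solve-∀
  *a₂ : ∀ d a b a′ b′ a″ b″ →
        (a * a′ + d * (b * b′)) * b″ + (a * b′ + b * a′) * a″ ≡
        a * (a′ * b″ + b′ * a″) + b * (a′ * a″ + d * (b′ * b″))
  *a₂ = solve-∀
  1*₁ : ∀ d a b → + 1 * a + d * (+ 0 * b) ≡ a
  1*₁ = solve-∀
  1*₂ : ∀ a b → + 1 * b + + 0 * a ≡ b
  1*₂ = solve-∀
  *1₁ : ∀ d a b → a * + 1 + d * (b * + 0) ≡ a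
  *1₁ = solve-∀
  *1₂ : ∀ a b → a * + 0 + b * + 1 ≡ b
  *1₂ = solve-∀
  dˡ₁ : ∀ d a b a′ b′ a″ b″ → a * (a′ + a″) + d * (b * (b′ + b″)) ≡
        (a * a′ + d * (b * b′)) + (a * a″ + d * (b * b″))
  dˡ₁ = solve-∀
  dˡ₂ : ∀ a b a′ b′ a″ b″ → a * (b′ + b″) + b * (a′ + a″) ≡ (a * b′ + b * a′) + (a * b″ + b * a″)
  dˡ₂ = solve-∀
  dʳ₁ : ∀ d a b a′ b′ a″ b″ → (a′ + a″) * a + d * ((b′ + b″) * b) ≡
        (a′ * a + d * (b′ * b)) + (a″ * a + d * (b″ * b))
  dʳ₁ = solve-∀
  dʳ₂ : ∀ a b a′ b′ a″ b″ → (a′ + a″) * b + (b′ + b″) * a ≡ (a′ * b + b′ * a) + (a″ * b + b″ * a)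
  dʳ₂ = solve-∀
  0*₁ : ∀ d a b → + 0 * a + d * (+ 0 * b) ≡ + 0
  0*₁ = solve-∀
  0*₂ : ∀ a b → + 0 * b + + 0 * a ≡ + 0
  0*₂ = solve-∀
  *0₁ : ∀ d a b → a * + 0 + d * (b * + 0) ≡ + 0
  *0₁ = solve-∀
  *0₂ : ∀ a b → a * + 0 + b * + 0 ≡ + 0
  *0₂ = solve-∀
  *c₁ : ∀ d a b a′ b′ → a * a′ + d * (b * b′) ≡ a′ * a + d * (b′ * b)
  *c₁ = solve-∀
  *c₂ : ∀ a b a′ b′ → a * b′ + b * a′ ≡ a′ * b + b′ * a
  *c₂ = solve-∀

module Quadratic (d : ℤ) where

  private module R = CommutativeSemiring (quadratic d)
  open Algebra.Properties.Semiring.Exp R.semiring using (^-homo-*) renaming (_^_ to _^ᴿ_)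

  A B : ℕ → ℤ → ℤ
  A m t = proj₁ ((t , + 1) ^ᴿ m)
  B m t = proj₂ ((t , + 1) ^ᴿ m)

  A-suc : ∀ m t → A (suc m) t ≡ t * A m t + d * B m t
  A-suc m t = lemma d t (A m t) (B m t)
    where
    lemma : ∀ d t a b → t * a + d * (+ 1 * b) ≡ t * a + d * b
    lemma = solve-∀

  B-suc : ∀ m t → B (suc m) t ≡ t * B m t + A m t
  B-suc m t = lemma t (A m t) (B m t)
    where
    lemma : ∀ t a b → t * b + + 1 * a ≡ t * b + a
    lemma = solve-∀

  B-+ : ∀ m n t → B (m ℕ.+ n) t ≡ A m t * B n t + B m t * A n t
  B-+ m n t = cong proj₂ (^-homo-* (t , + 1) m n)

  -- A² - d B² is the norm of the power of t + √d, and norms multiply; one more factor t + √d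
  -- contributes t² - d.
  norm : ∀ m t → A (suc m) t * A (suc m) t - d * (B (suc m) t * B (suc m) t) ≡
                 (t * t - d) * (A m t * A m t - d * (B m t * B m t))
  norm m t = lemma d t (A m t) (B m t)
    where
    lemma : ∀ d t a b → (t * a + d * (+ 1 * b)) * (t * a + d * (+ 1 * b))
                        - d * ((t * b + + 1 * a) * (t * b + + 1 * a)) ≡
                        (t * t - d) * (a * a - d * (b * b))
    lemma = solve-∀

  -- As a² - d = 4 b, the element a + √d is a root of x² - 2 a x + 4 b. Hence both sides satisfy
  -- x_{m+2} = 2 a x_{m+1} - 4 b x_m, and they agree at 0 and 1.
  U-B : ∀ a b → d ≡ a * a - + 4 * b → ∀ m → (+ 2) ^ m * U a b m ≡ + 2 * B m a
  U-B a b refl zero = refl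
  U-B a b refl (suc zero) = lemma a
    where
    lemma : ∀ a → + 2 * + 1 * + 1 ≡ + 2 * (a * + 0 + + 1 * + 1)
    lemma = solve-∀
  U-B a b refl (suc (suc m)) = begin
    + 2 * (+ 2 * w) * (a * U₁ - b * U₀)         ≡⟨ lemma₁ a b w U₁ U₀ ⟩
    + 2 * a * (+ 2 * w * U₁) - + 4 * b * (w * U₀)
      ≡⟨ cong₂ (λ u v → + 2 * a * u - + 4 * b * v) (U-B a b refl (suc m)) (U-B a b refl m) ⟩
    + 2 * a * (+ 2 * B (suc m) a) - + 4 * b * (+ 2 * B m a)
      ≡⟨ lemma₂ a b (A m a) (B m a) ⟩
    + 2 * B (suc (suc m)) a ∎
    where
    open ≡-Reasoning
    w = (+ 2) ^ m
    U₁ = U a b (suc m)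
    U₀ = U a b m
    lemma₁ : ∀ a b w u v → + 2 * (+ 2 * w) * (a * u - b * v) ≡
             + 2 * a * (+ 2 * w * u) - + 4 * b * (w * v)
    lemma₁ = solve-∀
    lemma₂ : ∀ a b x y → + 2 * a * (+ 2 * (a * y + + 1 * x)) - + 4 * b * (+ 2 * y) ≡
             + 2 * (a * (a * y + + 1 * x) + + 1 * (a * x + (a * a - + 4 * b) * (+ 1 * y)))
    lemma₂ = solve-∀

-- Iterated differences

Δ^ : ℕ → (ℤ → ℤ) → ℤ → ℤ
Δ^ zero    f t = f t
Δ^ (suc e) f t = Δ^ e f (t + + 1) - Δ^ e f t

Δ-cong : ∀ e {f g} → (∀ t → f t ≡ g t) → ∀ t → Δ^ e f t ≡ Δ^ e g t
Δ-cong zero    f≗g t = f≗g t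
Δ-cong (suc e) f≗g t = cong₂ _-_ (Δ-cong e f≗g (t + + 1)) (Δ-cong e f≗g t)

Δ-+ : ∀ e f g t → Δ^ e (λ t → f t + g t) t ≡ Δ^ e f t + Δ^ e g t
Δ-+ zero    f g t = refl
Δ-+ (suc e) f g t = trans (cong₂ _-_ (Δ-+ e f g (t + + 1)) (Δ-+ e f g t))
  (lemma (Δ^ e f (t + + 1)) (Δ^ e g (t + + 1)) (Δ^ e f t) (Δ^ e g t))
  where
  lemma : ∀ u v x y → (u + v) - (x + y) ≡ (u - x) + (v - y)
  lemma = solve-∀

Δ-*ˡ : ∀ e c f t → Δ^ e (λ t → c * f t) t ≡ c * Δ^ e f t
Δ-*ˡ zero    c f t = refl
Δ-*ˡ (suc e) c f t = trans (cong₂ _-_ (Δ-*ˡ e c f (t + + 1)) (Δ-*ˡ e c f t)) (lemma c _ _)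
  where
  lemma : ∀ c u v → c * u - c * v ≡ c * (u - v)
  lemma = solve-∀

-- This is the Leibniz rule for differences: the second difference of the factor t vanishes, so a
-- single correction term survives.
Δ-t* : ∀ e f t → Δ^ (suc e) (λ t → t * f t) t ≡ t * Δ^ (suc e) f t + + suc e * Δ^ e f (t + + 1)
Δ-t* zero f t = lemma t (f (t + + 1)) (f t)
  where
  lemma : ∀ t u v → (t + + 1) * u - t * v ≡ t * (u - v) + + 1 * u
  lemma = solve-∀
Δ-t* (suc e) f t = trans (cong₂ _-_ (Δ-t* e f (t + + 1)) (Δ-t* e f t))
  (lemma t (+ suc e) (Δ^ e f (t + + 1 + + 1)) (Δ^ e f (t + + 1)) (Δ^ e f t))
  where
  lemma : ∀ t k x y z → ((t + + 1) * (x - y) + k * x) - (t * (y - z) + k * y) ≡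
                        t * ((x - y) - (y - z)) + (+ 1 + k) * (x - y)
  lemma = solve-∀

Δ-∣ : ∀ {n} e f → (∀ t → n ∣ᶻ f t) → ∀ t → n ∣ᶻ Δ^ e f t
Δ-∣ zero    f n∣f t = n∣f t
Δ-∣ (suc e) f n∣f t = ∣m∣n⇒∣m-n (Δ-∣ e f n∣f (t + + 1)) (Δ-∣ e f n∣f t)

-- f behaves like a polynomial of degree at most e with leading coefficient c / e!.
Leading : ℕ → ℤ → (ℤ → ℤ) → Set
Leading e c f = ∀ t → Δ^ e f t ≡ c

Leading-suc : ∀ {e c f} → Leading e c f → Leading (suc e) (+ 0) f
Leading-suc {c = c} lead t = trans (cong₂ _-_ (lead (t + + 1)) (lead t)) (ℤ.+-inverseʳ c)

Leading-t* : ∀ {e c f} → Leading e c f → Leading (suc e) (+ suc e * c) (λ t → t * f t)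
Leading-t* {e} {c} {f} lead t = trans (Δ-t* e f t)
  (trans (cong₂ (λ u v → t * u + + suc e * v) (Leading-suc {e} {c} {f} lead t) (lead (t + + 1))) (lemma t _))
  where
  lemma : ∀ t u → t * + 0 + u ≡ u
  lemma = solve-∀

Leading-+ : ∀ {e c c′ f g} → Leading e c f → Leading e c′ g → Leading e (c + c′) (λ t → f t + g t)
Leading-+ {e} {f = f} {g} lf lg t = trans (Δ-+ e f g t) (cong₂ _+_ (lf t) (lg t))

Leading-0 : ∀ {e f} c → Leading e (+ 0) f → Leading e (+ 0) (λ t → c * f t)
Leading-0 {e} {f} c lf t = trans (Δ-*ˡ e c f t) (trans (cong (c *_) (lf t)) (ℤ.*-zeroʳ c))

Leading-cong : ∀ {e c f g} → (∀ t → g t ≡ f t) → Leading e c f → Leading e c g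
Leading-cong {e} g≗f lf t = trans (Δ-cong e g≗f t) (lf t)

module _ (d : ℤ) where
  open Quadratic d

  -- In usual terms `A m` is monic of degree m, and `B (suc m)` has degree m and leading coefficient
  -- m + 1, which turns m! into (m + 1)!. The middle component, that `B m` has degree below m, keeps
  -- d * B m from contributing to the top degree of `A (suc m)`.
  Leading-AB : ∀ m → Leading m (+ (m !)) (A m) × Leading m (+ 0) (B m) ×
                     Leading m (+ (suc m !)) (B (suc m))
  Leading-AB zero = (λ _ → refl) , (λ _ → refl) , lemma
    where
    lemma : ∀ t → t * + 0 + + 1 * + 1 ≡ + 1
    lemma = solve-∀
  Leading-AB (suc m) with Leading-AB m
  ... | lA , lB , lB′ = lA′ , Leading-suc {m} {f = B (suc m)} lB′ , lB″
    where
    lA′ : Leading (suc m) (+ (suc m !)) (A (suc m))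
    lA′ = subst (λ c → Leading (suc m) c (A (suc m))) (trans (ℤ.+-identityʳ _) (sym (ℤ.pos-* (suc m) (m !))))
            (Leading-cong {suc m} (A-suc m)
              (Leading-+ {suc m} {f = λ t → t * A m t} (Leading-t* {m} {f = A m} lA)
                (Leading-0 {suc m} {B m} d (Leading-suc {m} {f = B m} lB))))
    lB″ : Leading (suc m) (+ (suc (suc m) !)) (B (suc (suc m)))
    lB″ = subst (λ c → Leading (suc m) c (B (suc (suc m)))) eq
            (Leading-cong {suc m} (B-suc (suc m))
              (Leading-+ {suc m} {f = λ t → t * B (suc m) t} (Leading-t* {m} {f = B (suc m)} lB′) lA′))
      where
      eq : + suc m * + (suc m !) + + (suc m !) ≡ + (suc (suc m) !)
      eq = trans (cong (_+ + (suc m !)) (sym (ℤ.pos-* (suc m) (suc m !))))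
                 (cong +_ (ℕ.+-comm (suc m ℕ.* suc m !) (suc m !)))

  -- Only t² reaches the top degree m + 2, so the leading coefficient m + 1 is kept and the
  -- difference is (m + 1) (m + 2)!.
  Leading-normB : ∀ m → Leading (suc (suc m)) (+ suc (suc m) * (+ suc m * + (suc m !)))
                          (λ t → (t * t - d) * B (suc m) t)
  Leading-normB m = Leading-cong {suc (suc m)} (λ t → lemma d t (B (suc m) t))
    (subst (λ c → Leading (suc (suc m)) c (λ t → t * (t * B (suc m) t) + - d * B (suc m) t)) (ℤ.+-identityʳ _)
      (Leading-+ {suc (suc m)} {f = λ t → t * (t * B (suc m) t)}
        (Leading-t* {suc m} {f = λ t → t * B (suc m) t} (Leading-t* {m} {f = B (suc m)} lB))
        (Leading-0 {suc (suc m)} {B (suc m)} (- d)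
          (Leading-suc {suc m} {f = B (suc m)} (Leading-suc {m} {f = B (suc m)} lB)))))
    where
    lB = proj₂ (proj₂ (Leading-AB m))
    lemma : ∀ d t b → (t * t - d) * b ≡ t * (t * b) + - d * b
    lemma = solve-∀

-- Divisibility by a prime in ℤ and Fermat's little theorem.

euclidsLemmaℤ : ∀ {p} → Prime p → ∀ x y → + p ∣ᶻ x * y → + p ∣ᶻ x ⊎ + p ∣ᶻ y
euclidsLemmaℤ {p} p-prime x y p∣xy = Sum.map ∣ᵤ⇒∣ ∣ᵤ⇒∣
  (euclidsLemma ℤ.∣ x ∣ ℤ.∣ y ∣ p-prime (subst (p ℕ.∣_) (ℤ.abs-* x y) (∣⇒∣ᵤ p∣xy)))

prime-cancelˡ : ∀ {p} → Prime p → ∀ x y → ¬ + p ∣ᶻ x → + p ∣ᶻ x * y → + p ∣ᶻ y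
prime-cancelˡ p-prime x y p∤x p∣xy = [ (λ p∣x → contradiction p∣x p∤x) , id ]′ (euclidsLemmaℤ p-prime x y p∣xy)

∣-resp : ∀ {n x y} → x ≡ y → n ∣ᶻ x → n ∣ᶻ y
∣-resp refl h = h

prime∤1 : ∀ {p} → Prime p → ¬ + p ∣ᶻ + 1
prime∤1 p-prime p∣1 = ¬prime[1] (subst Prime (ℕ.∣1⇒≡1 (∣⇒∣ᵤ p∣1)) p-prime)

^-congruence : ∀ n x y → (x - y) ∣ᶻ (x ^ n - y ^ n)
^-congruence zero x y = divides (+ 0) refl
^-congruence (suc n) x y = ∣-resp (lemma x y (x ^ n) (y ^ n))
  (∣m∣n⇒∣m+n (∣n⇒∣m*n x (^-congruence n x y)) (∣n⇒∣m*n (y ^ n) ∣-refl))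
  where
  lemma : ∀ x y u v → x * (u - v) + v * (x - y) ≡ x * u - y * v
  lemma = solve-∀

integerInduction : ∀ {ℓ} (P : ℤ → Set ℓ) → P (+ 0) → (∀ x → P x → P (x + + 1)) →
                   (∀ x → P (x + + 1) → P x) → ∀ x → P x
integerInduction P p0 up down (+ zero) = p0
integerInduction P p0 up down (+ suc n) =
  subst P (cong +_ (ℕ.+-comm n 1)) (up (+ n) (integerInduction P p0 up down (+ n)))
integerInduction P p0 up down -[1+ zero ] = down -[1+ 0 ] p0
integerInduction P p0 up down -[1+ suc n ] = down -[1+ suc n ] (integerInduction P p0 up down -[1+ n ])

module ℤ^ = Algebra.Properties.Semiring.Exp (CommutativeSemiring.semiring ℤ.+-*-commutativeSemiring)
module ℤ× = Algebra.Properties.Semiring.Mult (CommutativeSemiring.semiring ℤ.+-*-commutativeSemiring)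

ℤ^≡^ : ∀ x n → x ℤ^.^ n ≡ x ^ n
ℤ^≡^ x zero    = refl
ℤ^≡^ x (suc n) = cong (x *_) (ℤ^≡^ x n)

ℤ×≡* : ∀ n x → n ℤ×.× x ≡ + n * x
ℤ×≡* zero    x = refl
ℤ×≡* (suc n) x = trans (cong (ℤ._+_ x) (ℤ×≡* n x)) (lemma (+ n) x)
  where
  lemma : ∀ n x → x + n * x ≡ (+ 1 + n) * x
  lemma = solve-∀

frobeniusℤ : ∀ {p} → Prime p → ∀ x y → ∃ λ z → (x + y) ^ p ≡ x ^ p + y ^ p + + p * z
frobeniusℤ {p} p-prime x y with Frobenius.frobenius ℤ.+-*-commutativeSemiring p-prime x y
... | z , eq = z , trans (sym (ℤ^≡^ (x + y) p))
                     (trans eq (cong₂ _+_ (cong₂ _+_ (ℤ^≡^ x p) (ℤ^≡^ y p)) (ℤ×≡* p z)))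

-- By the Frobenius congruence, x^p - x does not change modulo p when x becomes x + 1, so its
-- vanishing at 0 spreads over ℤ in both directions.
fermat : ∀ {p} → Prime p → ∀ x → + p ∣ᶻ x ^ p - x
fermat {p} p-prime = integerInduction (λ x → + p ∣ᶻ x ^ p - x) (base p-prime)
  (λ x h → ∣m+n∣n⇒∣m (step x) (∣m⇒∣-m h))
  (λ x h → ∣-resp (lemma₂ ((x + + 1) ^ p - (x + + 1)) (x ^ p - x)) (∣m∣n⇒∣m-n h (step x)))
  where
  base : ∀ {p} → Prime p → + p ∣ᶻ (+ 0) ^ p - + 0
  base {zero} 0-prime = contradiction 0-prime ¬prime[0]
  base {suc p} _ = divides (+ 0) refl
  lemma₁ : ∀ x u p z → (u + + 1 + p * z - (x + + 1)) + - (u - x) ≡ z * p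
  lemma₁ = solve-∀
  lemma₂ : ∀ u v → u - (u + - v) ≡ v
  lemma₂ = solve-∀
  step : ∀ x → + p ∣ᶻ ((x + + 1) ^ p - (x + + 1)) + - (x ^ p - x)
  step x with frobeniusℤ p-prime x (+ 1)
  ... | z , eq = divides z (trans
    (cong (λ u → (u - (x + + 1)) + - (x ^ p - x))
      (trans eq (cong (λ v → x ^ p + v + + p * z) (ℤ.^-zeroˡ p))))
    (lemma₁ x (x ^ p) (+ p) z))

-- Powers of t + √d modulo an odd prime.

module _ (d : ℤ) where
  open Quadratic d
  private
    module R = CommutativeSemiring (quadratic d)
    module R^ = Algebra.Properties.Semiring.Exp R.semiring
    module R× = Algebra.Properties.Semiring.Mult R.semiring

  ×-components : ∀ n u v → n R×.× (u , v) ≡ (+ n * u , + n * v)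
  ×-components zero    u v = refl
  ×-components (suc n) u v = trans (cong ((u , v) R.+_) (×-components n u v))
                                   (cong₂ _,_ (lemma (+ n) u) (lemma (+ n) v))
    where
    lemma : ∀ n x → x + n * x ≡ (+ 1 + n) * x
    lemma = solve-∀

  rational^ : ∀ x n → (x , + 0) R^.^ n ≡ (x ^ n , + 0)
  rational^ x zero    = refl
  rational^ x (suc n) = trans (cong ((x , + 0) R.*_) (rational^ x n))
                              (cong₂ _,_ (lemma₁ d x (x ^ n)) (lemma₂ x (x ^ n)))
    where
    lemma₁ : ∀ d x u → x * u + d * (+ 0 * + 0) ≡ x * u
    lemma₁ = solve-∀
    lemma₂ : ∀ x u → x * + 0 + + 0 * u ≡ + 0
    lemma₂ = solve-∀

  √d^odd : ∀ h → (+ 0 , + 1) R^.^ suc (h ℕ.+ h) ≡ (+ 0 , d ^ h)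
  √d^odd zero = cong₂ _,_ (lemma d) refl
    where
    lemma : ∀ d → + 0 * + 1 + d * (+ 1 * + 0) ≡ + 0
    lemma = solve-∀
  √d^odd (suc h) rewrite ℕ.+-suc h h =
    trans (cong (λ z → (+ 0 , + 1) R.* ((+ 0 , + 1) R.* z)) (√d^odd h))
          (cong₂ _,_ (lemma₁ d (d ^ h)) (lemma₂ d (d ^ h)))
    where
    lemma₁ : ∀ d u → + 0 * (+ 0 * + 0 + d * (+ 1 * u)) + d * (+ 1 * (+ 0 * u + + 1 * + 0)) ≡ + 0
    lemma₁ = solve-∀
    lemma₂ : ∀ d u → + 0 * (+ 0 * u + + 1 * + 0) + + 1 * (+ 0 * + 0 + d * (+ 1 * u)) ≡ d * u
    lemma₂ = solve-∀

  -- Both are polynomials in t with integer coefficients; they are carried together because their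
  -- recurrences mix them.
  B-congruence : ∀ m x y → (x - y) ∣ᶻ (A m x - A m y) × (x - y) ∣ᶻ (B m x - B m y)
  B-congruence zero x y = divides (+ 0) refl , divides (+ 0) refl
  B-congruence (suc m) x y with B-congruence m x y
  ... | a , b =
    ∣-resp (lemma₁ d x y (A m x) (A m y) (B m x) (B m y))
      (∣m∣n⇒∣m+n (∣m∣n⇒∣m+n (∣n⇒∣m*n x a) (∣n⇒∣m*n (A m y) ∣-refl)) (∣n⇒∣m*n d b)) ,
    ∣-resp (lemma₂ x y (A m x) (A m y) (B m x) (B m y))
      (∣m∣n⇒∣m+n (∣m∣n⇒∣m+n (∣n⇒∣m*n x b) (∣n⇒∣m*n (B m y) ∣-refl)) a)
    where
    lemma₁ : ∀ d x y a a′ b b′ → x * (a - a′) + a′ * (x - y) + d * (b - b′) ≡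
             (x * a + d * (+ 1 * b)) - (y * a′ + d * (+ 1 * b′))
    lemma₁ = solve-∀
    lemma₂ : ∀ x y a a′ b b′ → x * (b - b′) + b′ * (x - y) + (a - a′) ≡
             (x * b + + 1 * a) - (y * b′ + + 1 * a′)
    lemma₂ = solve-∀

  module OddPrime {p h} (p-prime : Prime p) (p≡1+2h : p ≡ suc (h ℕ.+ h)) (p∤d : ¬ + p ∣ᶻ d) where

    -- Since h = (p - 1) / 2, Euler's criterion identifies this with the Legendre symbol of d modulo
    -- p.
    ε : ℤ
    ε = d ^ h

    -- Modulo p, (t + √d)^p ≡ t^p + (√d)^p ≡ t + d^h √d, by Frobenius for the summands t and √d and
    -- Fermat for t.
    frobenius-AB : ∀ t → + p ∣ᶻ A p t - t × + p ∣ᶻ B p t - ε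
    frobenius-AB t with Frobenius.frobenius (quadratic d) p-prime (t , + 0) (+ 0 , + 1)
    ... | (u , v) , eq =
        ∣-resp (lemma (A p t) (t ^ p) t)
          (∣m∣n⇒∣m+n (fermat p-prime t) (divides u (trans (cong (_- t ^ p) A≡) (lemma₁ (t ^ p) (+ p) u))))
      , divides v (trans (cong (_- ε) B≡) (lemma₂ ε (+ p) v))
      where
      √d^p : (+ 0 , + 1) R^.^ p ≡ (+ 0 , ε)
      √d^p = trans (cong ((+ 0 , + 1) R^.^_) p≡1+2h) (√d^odd h)
      eq′ : (A p t , B p t) ≡ (t ^ p + + 0 + + p * u , + 0 + ε + + p * v)
      eq′ = trans (cong (λ x → (x , + 1) R^.^ p) (sym (ℤ.+-identityʳ t)))
             (trans eq (cong₂ R._+_ (cong₂ R._+_ (rational^ t p) √d^p) (×-components p u v)))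
      A≡ = cong proj₁ eq′
      B≡ = cong proj₂ eq′
      lemma : ∀ a b t → (b - t) + (a - b) ≡ a - t
      lemma = solve-∀
      lemma₁ : ∀ b p u → (b + + 0 + p * u) - b ≡ u * p
      lemma₁ = solve-∀
      lemma₂ : ∀ e p u → (+ 0 + e + p * u) - e ≡ u * p
      lemma₂ = solve-∀

    ε-fermat : ∀ x → ¬ + p ∣ᶻ x → + p ∣ᶻ x ^ h * x ^ h - + 1
    ε-fermat x p∤x = prime-cancelˡ p-prime x (x ^ h * x ^ h - + 1) p∤x (∣-resp eq (fermat p-prime x))
      where
      lemma : ∀ x u → x * (u * u) - x ≡ x * (u * u - + 1)
      lemma = solve-∀
      eq : x ^ p - x ≡ x * (x ^ h * x ^ h - + 1)
      eq = trans (cong (λ i → x ^ i - x) p≡1+2h)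
             (trans (cong (λ u → x * u - x) (ℤ.^-distribˡ-+-* x h h)) (lemma x (x ^ h)))

    ε≡±1 : + p ∣ᶻ ε - + 1 ⊎ + p ∣ᶻ ε + + 1
    ε≡±1 = euclidsLemmaℤ p-prime (ε - + 1) (ε + + 1) (∣-resp (lemma ε) (ε-fermat d p∤d))
      where
      lemma : ∀ e → e * e - + 1 ≡ (e - + 1) * (e + + 1)
      lemma = solve-∀

    -- d^h ≡ s^(2h) = s^(p - 1) ≡ 1, where s is prime to p because d is.
    square⇒ε≡1 : ∀ s → + p ∣ᶻ s * s - d → + p ∣ᶻ ε - + 1
    square⇒ε≡1 s p∣ = ∣-resp (lemma ((s * s) ^ h) ε)
      (∣m∣n⇒∣m-n (subst (λ u → + p ∣ᶻ u - + 1) (^-square h) (ε-fermat s p∤s)) (∣-trans p∣ (^-congruence h (s * s) d)))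
      where
      lemma : ∀ u e → (u - + 1) - (u - e) ≡ e - + 1
      lemma = solve-∀
      lemma₁ : ∀ s d → s * s - (s * s - d) ≡ d
      lemma₁ = solve-∀
      p∤s : ¬ + p ∣ᶻ s
      p∤s p∣s = p∤d (∣-resp (lemma₁ s d) (∣m∣n⇒∣m-n (∣n⇒∣m*n s p∣s) p∣))
      lemma₂ : ∀ s u → (s * u) * (s * u) ≡ (s * s) * (u * u)
      lemma₂ = solve-∀
      ^-square : ∀ k → s ^ k * s ^ k ≡ (s * s) ^ k
      ^-square zero    = refl
      ^-square (suc k) = trans (lemma₂ s (s ^ k)) (cong ((s * s) *_) (^-square k))

    -- Here (t + √d)^p ≡ t + √d. Multiplying by the conjugate t - √d and comparing coefficients of
    -- √d gives (t² - d) B_{p-1} ≡ 0, and t² - d cancels.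
    ε≡1⇒∣B : + p ∣ᶻ ε - + 1 → ∀ t → ¬ + p ∣ᶻ t * t - d → + p ∣ᶻ B (h ℕ.+ h) t
    ε≡1⇒∣B p∣ε-1 t p∤N = prime-cancelˡ p-prime (t * t - d) (B n t) p∤N (∣-resp (lemma d t (A n t) (B n t) ε)
      (∣m∣n⇒∣m-n (∣n⇒∣m*n t (∣m∣n⇒∣m+n (∣-resp (cong (λ i → B i t - ε) p≡1+2h) (proj₂ (frobenius-AB t))) p∣ε-1))
                  (∣-resp (cong (λ i → A i t - t) p≡1+2h) (proj₁ (frobenius-AB t)))))
      where
      n = h ℕ.+ h
      lemma : ∀ d t a b e → t * (((t * b + + 1 * a) - e) + (e - + 1)) - ((t * a + d * (+ 1 * b)) - t) ≡
                            (t * t - d) * b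
      lemma = solve-∀

    -- Here (t + √d)^p is congruent to the conjugate t - √d, so the next power is congruent to the
    -- norm t² - d, which has no √d part.
    ε≡-1⇒∣B : + p ∣ᶻ ε + + 1 → ∀ t → + p ∣ᶻ B (suc p) t
    ε≡-1⇒∣B p∣ε+1 t = ∣-resp (lemma t (A p t) (B p t) ε)
      (∣m∣n⇒∣m+n (∣n⇒∣m*n t (∣m∣n⇒∣m+n (proj₂ (frobenius-AB t)) p∣ε+1)) (proj₁ (frobenius-AB t)))
      where
      lemma : ∀ t a b e → t * ((b - e) + (e + + 1)) + (a - t) ≡ t * b + + 1 * a
      lemma = solve-∀

    ∤norm : ∀ m t → ¬ + p ∣ᶻ t * t - d → ¬ + p ∣ᶻ A m t * A m t - d * (B m t * B m t)
    ∤norm zero t p∤N p∣1 = prime∤1 p-prime (∣-resp (lemma d) p∣1)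
      where
      lemma : ∀ d → + 1 * + 1 - d * (+ 0 * + 0) ≡ + 1
      lemma = solve-∀
    ∤norm (suc m) t p∤N p∣ = ∤norm m t p∤N
      (prime-cancelˡ p-prime (t * t - d) (A m t * A m t - d * (B m t * B m t)) p∤N (∣-resp (norm m t) p∣))

    -- A prime dividing both components would divide the norm, which is a power of t² - d.
    ∣B⇒∤A : ∀ m t → ¬ + p ∣ᶻ t * t - d → + p ∣ᶻ B m t → ¬ + p ∣ᶻ A m t
    ∣B⇒∤A m t p∤N p∣B p∣A = ∤norm m t p∤N
      (∣m∣n⇒∣m-n (∣m⇒∣m*n (A m t) p∣A) (∣n⇒∣m*n d (∣m⇒∣m*n (B m t) p∣B)))

    -- Modulo p the l-th power of t + √d is the rational unit A_l, so the addition formula for `B`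
    -- lets l be taken off the exponent repeatedly.
    ∣B-reduce : ∀ l t → ¬ + p ∣ᶻ t * t - d → + p ∣ᶻ B l t → ∀ k m → + p ∣ᶻ B (k ℕ.* l ℕ.+ m) t → + p ∣ᶻ B m t
    ∣B-reduce l t p∤N p∣Bl zero m p∣B = p∣B
    ∣B-reduce l t p∤N p∣Bl (suc k) m p∣B = ∣B-reduce l t p∤N p∣Bl k m
      (prime-cancelˡ p-prime (A l t) (B (k ℕ.* l ℕ.+ m) t) (∣B⇒∤A l t p∤N p∣Bl)
        (∣m+n∣n⇒∣m (∣-resp (trans (cong (λ i → B i t) (ℕ.+-assoc l (k ℕ.* l) m)) (B-+ l (k ℕ.* l ℕ.+ m) t)) p∣B)
                   (∣m⇒∣m*n (A (k ℕ.* l ℕ.+ m) t) p∣Bl)))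

    ∣B-% : ∀ l .{{_ : ℕ.NonZero l}} n t → ¬ + p ∣ᶻ t * t - d → + p ∣ᶻ B l t → + p ∣ᶻ B n t → + p ∣ᶻ B (n % l) t
    ∣B-% l n t p∤N p∣Bl p∣Bn = ∣B-reduce l t p∤N p∣Bl (n / l) (n % l)
      (∣-resp (cong (λ i → B i t) (trans (m≡m%n+[m/n]*n n l) (ℕ.+-comm (n % l) _))) p∣Bn)

    +p∤! : ∀ n → n ℕ.< p → ¬ + p ∣ᶻ + (n !)
    +p∤! n n<p p∣n! = prime∤! p-prime n n<p (∣⇒∣ᵤ p∣n!)

    +p∤suc : ∀ n → suc n ℕ.< p → ¬ + p ∣ᶻ + suc n
    +p∤suc n n<p p∣n = ℕ.<⇒≱ n<p (ℕ.∣⇒≤ (∣⇒∣ᵤ p∣n))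

    -- The m-th difference of `B (suc m)` is the constant (m + 1)!, prime to p because m + 1 < p.
    B-nonvanishing : ∀ m → suc m ℕ.< p → ¬ (∀ t → + p ∣ᶻ B (suc m) t)
    B-nonvanishing m m<p p∣B = +p∤! (suc m) m<p
      (∣-resp (proj₂ (proj₂ (Leading-AB d m)) (+ 0)) (Δ-∣ m (B (suc m)) p∣B (+ 0)))

    -- The factor t² - d covers the residues t for which B is not known to vanish.
    normB-nonvanishing : ∀ m → suc (suc m) ℕ.< p → ¬ (∀ t → + p ∣ᶻ (t * t - d) * B (suc m) t)
    normB-nonvanishing m m<p p∣B =
      +p∤! (suc m) (ℕ.<-trans (ℕ.n<1+n _) m<p)
        (prime-cancelˡ p-prime (+ suc m) (+ (suc m !)) (+p∤suc m (ℕ.<-trans (ℕ.n<1+n _) m<p))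
          (prime-cancelˡ p-prime (+ suc (suc m)) (+ suc m * + (suc m !)) (+p∤suc (suc m) m<p)
            (∣-resp (Leading-normB d m (+ 0)) (Δ-∣ (suc (suc m)) (λ t → (t * t - d) * B (suc m) t) p∣B (+ 0)))))

    -- A nonzero remainder m + 1 of n modulo p - 1 would make (t² - d) B_{m+1} vanish modulo p for
    -- every t, although its degree m + 2 is below p.
    split⇒p-1∣ : ∀ s → + p ∣ᶻ s * s - d → ∀ n → (∀ t → ¬ + p ∣ᶻ t * t - d → + p ∣ᶻ B n t) → h ℕ.+ h ∣ n
    split⇒p-1∣ s p∣ n p∣B = ℕ.m%n≡0⇒n∣m n l (go (n % l) refl)
      where
      l = h ℕ.+ h
      l≢0 : ℕ.NonZero l
      l≢0 = ℕ.≢-nonZero (λ l≡0 → ¬prime[1] (subst Prime (trans p≡1+2h (cong suc l≡0)) p-prime))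
      instance
        _ = l≢0
      go : ∀ m → n % l ≡ m → m ≡ 0
      go zero _ = refl
      go (suc m) eq = ⊥-elim (normB-nonvanishing m
        (subst (suc (suc m) ℕ.<_) (sym p≡1+2h) (s≤s (subst (ℕ._< l) eq (m%n<n n l)))) vanish)
        where
        vanish : ∀ t → + p ∣ᶻ (t * t - d) * B (suc m) t
        vanish t with + p ∣? (t * t - d)
        ... | yes p∣N = ∣m⇒∣m*n _ p∣N
        ... | no p∤N = ∣n⇒∣m*n (t * t - d)
          (subst (λ i → + p ∣ᶻ B i t) eq (∣B-% l n t p∤N (ε≡1⇒∣B (square⇒ε≡1 s p∣) t p∤N) (p∣B t p∤N)))

    -- If ε were 1 modulo p, then B_{p-1} would vanish at every t, as t² - d is never divisible by
    -- p; its degree p - 2 forbids this. So this half of Euler's criterion comes from the same root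
    -- count.
    inert⇒ε≡-1 : (∀ t → ¬ + p ∣ᶻ t * t - d) → + p ∣ᶻ ε + + 1
    inert⇒ε≡-1 inert = [ (λ ε≡1 → ⊥-elim (go ε≡1 (h ℕ.+ h) refl)) , id ]′ ε≡±1
      where
      go : + p ∣ᶻ ε - + 1 → ∀ m → h ℕ.+ h ≡ m → ⊥
      go ε≡1 zero eq = ¬prime[1] (subst Prime (trans p≡1+2h (cong suc eq)) p-prime)
      go ε≡1 (suc m) eq = B-nonvanishing m (ℕ.≤-reflexive (sym (trans p≡1+2h (cong suc eq))))
        (λ t → subst (λ i → + p ∣ᶻ B i t) eq (ε≡1⇒∣B ε≡1 t (inert t)))

    -- A nonzero remainder modulo p + 1 lies between 1 and p. Below p the root count applies to `B`
    -- itself; the value p is excluded separately.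
    inert⇒p+1∣ : (∀ t → ¬ + p ∣ᶻ t * t - d) → ∀ n → (∀ t → ¬ + p ∣ᶻ t * t - d → + p ∣ᶻ B n t) → suc p ∣ n
    inert⇒p+1∣ inert n p∣B = ℕ.m%n≡0⇒n∣m n l (go (n % l) refl)
      where
      l = suc p
      ε≡-1 = inert⇒ε≡-1 inert
      go : ∀ m → n % l ≡ m → m ≡ 0
      go zero _ = refl
      go (suc m) eq = ⊥-elim ([ (λ m<p → B-nonvanishing m m<p vanish) , m≡p⇒⊥ ]′ (ℕ.m≤n⇒m<n∨m≡n
        (ℕ.s≤s⁻¹ (subst (ℕ._< l) eq (m%n<n n l)))))
        where
        vanish : ∀ t → + p ∣ᶻ B (suc m) t
        vanish t = subst (λ i → + p ∣ᶻ B i t) eq (∣B-% l n t (inert t) (ε≡-1⇒∣B ε≡-1 t) (p∣B t (inert t)))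
        t₀ = + 0
        lemma : ∀ b e → (e + + 1) + ((b - e) - b) ≡ + 1
        lemma = solve-∀
        -- The leading coefficient of B p is divisible by p, but B p is the constant ε modulo p.
        m≡p⇒⊥ : suc m ≡ p → ⊥
        m≡p⇒⊥ m≡p = prime∤1 p-prime (∣-resp (lemma (B p t₀) ε)
          (∣m∣n⇒∣m+n ε≡-1 (∣m∣n⇒∣m-n (proj₂ (frobenius-AB t₀)) (subst (λ i → + p ∣ᶻ B i t₀) m≡p (vanish t₀)))))

-- The Jacobi symbol

residue-unique : ∀ {p a b} → a ℕ.< p → b ℕ.< p → + p ∣ᶻ + a - + b → a ≡ b
residue-unique {p} {a} {b} a<p b<p p∣a-b = go (∣⇒∣ᵤ p∣a-b)
  where
  bound : ℤ.∣ + a - + b ∣ ℕ.< p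
  bound rewrite ℤ.m-n≡m⊖n a b with b ℕ.≤? a
  ... | yes b≤a rewrite ℤ.⊖-≥ b≤a = ℕ.≤-<-trans (ℕ.m∸n≤m a b) a<p
  ... | no b≰a rewrite ℤ.∣⊖∣-≰ {b} {a} b≰a = ℕ.≤-<-trans (ℕ.m∸n≤m b a) b<p
  go : p ℕ.∣ ℤ.∣ + a - + b ∣ → a ≡ b
  go p∣ = ℤ.+-injective (ℤ.i-j≡0⇒i≡j (+ a) (+ b) (ℤ.∣i∣≡0⇒i≡0 (zero-of ℤ.∣ + a - + b ∣ bound p∣)))
    where
    zero-of : ∀ n → n ℕ.< p → p ∣ n → n ≡ 0
    zero-of zero _ _ = refl
    zero-of (suc n) n<p p∣n = contradiction n<p (ℕ.≤⇒≯ (ℕ.∣⇒≤ p∣n))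

∣m-m%n : ∀ m n .{{_ : ℕ.NonZero n}} → + n ∣ᶻ + m - + (m % n)
∣m-m%n m n = divides (+ (m / n)) (trans
  (cong (_- + (m % n)) (trans (cong +_ (m≡m%n+[m/n]*n m n)) (cong (ℤ._+_ (+ (m % n))) (ℤ.pos-* (m / n) n))))
  (lemma (+ (m % n)) (+ (m / n) * + n)))
  where
  lemma : ∀ r u → (r + u) - r ≡ u
  lemma = solve-∀

∣i-i%ℕn : ∀ i n .{{_ : ℕ.NonZero n}} → + n ∣ᶻ i - + (i %ℕ n)
∣i-i%ℕn i n = divides (i /ℕ n) (trans (cong (_- + (i %ℕ n)) (a≡a%ℕn+[a/ℕn]*n i n)) (lemma (+ (i %ℕ n)) (i /ℕ n * + n)))
  where
  lemma : ∀ r u → (r + u) - r ≡ u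
  lemma = solve-∀

-- `legendre₂₊` expects the prime lowered by 2. At 0 and 1 the truncated subtraction gives a
-- meaningless value, but the comparison with `jacobi` concerns primes only.
legendre : ℤ → ℕ → ℤ
legendre d p = legendre₂₊ d (p ℕ.∸ 2)

-- The definition searches only the residues below p. A hit is itself a root; conversely an integer
-- root t would be found as its residue, so a failed search rules out every integer.
legendre₂₊-spec : ∀ d j → let p = suc (suc j) in ¬ + p ∣ᶻ d →
  (legendre₂₊ d j ≡ + 1 × ∃ λ s → + p ∣ᶻ s * s - d) ⊎
  (legendre₂₊ d j ≡ -[1+ 0 ] × ∀ t → ¬ + p ∣ᶻ t * t - d)
legendre₂₊-spec d j p∤d with d %ℕ suc (suc j) in d%p≡
... | zero = contradiction (divides (d /ℕ suc (suc j))
               (trans (a≡a%ℕn+[a/ℕn]*n d (suc (suc j))) (trans (cong (λ r → + r + d /ℕ suc (suc j) * + suc (suc j)) d%p≡) (ℤ.+-identityˡ _)))) p∤d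
... | rd@(suc _) with any (λ x → ⌊ (x ℕ.* x) % suc (suc j) ℕ.≟ rd ⌋) (upTo (suc (suc j))) in any≡
...   | true  = inj₁ (refl , root (find (Any.any⁻ (λ x → ⌊ (x ℕ.* x) % p ℕ.≟ rd ⌋) (upTo p) (Equivalence.from T-≡ any≡))))
  where
  p = suc (suc j)
  root : (∃ λ x → x ∈ upTo p × T ⌊ (x ℕ.* x) % p ℕ.≟ rd ⌋) → ∃ λ s → + p ∣ᶻ s * s - d
  root (x , _ , x²≡) = + x , ∣-resp (trans (lemma (+ (x ℕ.* x)) (+ rd) d) (cong (_- d) (ℤ.pos-* x x)))
    (∣m∣n⇒∣m-n (subst (λ r → + p ∣ᶻ + (x ℕ.* x) - + r) (toWitness {a? = _ ℕ.≟ _} x²≡) (∣m-m%n (x ℕ.* x) p))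
               (subst (λ r → + p ∣ᶻ d - + r) d%p≡ (∣i-i%ℕn d p)))
    where
    lemma : ∀ u r d → (u - r) - (d - r) ≡ u - d
    lemma = solve-∀
...   | false = inj₂ (refl , λ t p∣t²-d → subst T any≡ (Any.any⁺ (λ x → ⌊ (x ℕ.* x) % p ℕ.≟ rd ⌋)
    (lose (∈-upTo⁺ (n%ℕd<d t p)) (fromWitness {a? = _ ℕ.≟ _} (square≡ t p∣t²-d)))))
  where
  p = suc (suc j)
  square≡ : ∀ t → + p ∣ᶻ t * t - d → ((t %ℕ p) ℕ.* (t %ℕ p)) % p ≡ rd
  square≡ t p∣t²-d = residue-unique (m%n<n (x ℕ.* x) p) (subst (ℕ._< p) d%p≡ (n%ℕd<d d p))
    (∣-resp (trans (cong (λ u → (t * t - d) + (d - + rd) - (t - + x) * (t + + x) - (u - + ((x ℕ.* x) % p))) (ℤ.pos-* x x))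
                   (lemma t (+ x) d (+ rd) (+ ((x ℕ.* x) % p))))
      (∣m∣n⇒∣m-n (∣m∣n⇒∣m-n (∣m∣n⇒∣m+n p∣t²-d (subst (λ r → + p ∣ᶻ d - + r) d%p≡ (∣i-i%ℕn d p)))
                             (∣m⇒∣m*n (t + + x) (∣i-i%ℕn t p)))
                 (∣m-m%n (x ℕ.* x) p)))
    where
    x = t %ℕ p
    lemma : ∀ t x d r s → (t * t - d) + (d - r) - (t - x) * (t + x) - (x * x - s) ≡ s - r
    lemma = solve-∀

legendreProduct : ℤ → List ℕ → ℤ
legendreProduct d ps = foldr _*_ (+ 1) (map (legendre d) ps)

legendreProduct-++ : ∀ d ps qs → legendreProduct d (ps ++ qs) ≡ legendreProduct d ps * legendreProduct d qs
legendreProduct-++ d [] qs = sym (ℤ.*-identityˡ _)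
legendreProduct-++ d (p ∷ ps) qs = trans (cong (legendre d p *_) (legendreProduct-++ d ps qs))
  (sym (ℤ.*-assoc (legendre d p) (legendreProduct d ps) (legendreProduct d qs)))

legendreProduct-↭ : ∀ d {ps qs} → ps ↭ qs → legendreProduct d ps ≡ legendreProduct d qs
legendreProduct-↭ d ps↭qs = foldr-commMonoid (setoid ℤ) ℤ.*-1-isCommutativeMonoid (↭⇒↭ₛ (↭.map⁺ (legendre d) ps↭qs))

-- The candidate divisor is j + 2, and f + j never decreases below m: this is why the fuel suffices.
jacAux-factors : ∀ f j d m .{{_ : ℕ.NonZero m}} → (2 ℕ.+ j) Rough m → m ℕ.≤ f ℕ.+ j →
  ∃ λ ps → All Prime ps × m ≡ product ps × jacAux f j d m ≡ legendreProduct d ps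
jacAux-factors zero j d (suc zero) _ _ = [] , [] , refl , refl
jacAux-factors zero j d m@(suc (suc _)) rough m≤j =
  contradiction (ℕ.≤-trans (rough⇒≤ rough) m≤j) (ℕ.<⇒≱ (ℕ.m≤n+m (suc j) 1))
jacAux-factors (suc f) j d (suc zero) _ _ = [] , [] , refl , refl
jacAux-factors (suc f) j d m@(suc (suc _)) rough m≤ with suc (suc j) ℕ.∣? m
... | no k∤m = jacAux-factors f (suc j) d m (∤⇒rough-suc k∤m rough) (subst (m ℕ.≤_) (sym (ℕ.+-suc f j)) m≤)
... | yes k∣m with jacAux-factors f j d (m / suc (suc j)) {{ℕ.≢-nonZero m/k≢0}} (rough∧∣⇒rough rough m/k∣m)
                     (ℕ.s≤s⁻¹ (ℕ.≤-trans (m/n<m m (suc (suc j)) (s≤s (s≤s z≤n))) m≤))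
  where
  m/k*k≡m : m / suc (suc j) ℕ.* suc (suc j) ≡ m
  m/k*k≡m = m/n*n≡m k∣m
  m/k∣m : m / suc (suc j) ∣ m
  m/k∣m = ℕ.divides (suc (suc j)) (sym (trans (ℕ.*-comm (suc (suc j)) (m / suc (suc j))) m/k*k≡m))
  m/k≢0 : m / suc (suc j) ≢ 0
  m/k≢0 eq with trans (sym m/k*k≡m) (cong (ℕ._* suc (suc j)) eq)
  ... | ()
...   | ps , primes , m/k≡ , jac≡ =
    suc (suc j) ∷ ps , rough∧∣⇒prime rough k∣m ∷ primes
  , trans (sym (m/n*n≡m k∣m)) (trans (ℕ.*-comm (m / suc (suc j)) (suc (suc j))) (cong (suc (suc j) ℕ.*_) m/k≡))
  , cong (legendre₂₊ d j *_) jac≡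

-- Trial division yields one prime factorisation, and uniqueness up to order transfers the value to
-- any other.
jacobi-factors : ∀ d {m} .{{_ : ℕ.NonZero m}} (fm : PrimeFactorisation m) →
                 jacobi d m ≡ legendreProduct d (PrimeFactorisation.factors fm)
jacobi-factors d {m} fm with jacAux-factors (m ℕ.+ m) 0 d m 2-rough
                               (ℕ.≤-trans (ℕ.m≤m+n m m) (ℕ.m≤m+n (m ℕ.+ m) 0))
... | ps , primes , m≡ , jac≡ = trans jac≡ (legendreProduct-↭ d
  (factorisationUnique (record { factors = ps ; isFactorisation = m≡ ; factorsPrime = primes }) fm))

-- Concatenating factorisations of `m` and `n` gives one of the product, which avoids following the
-- trial division of the product.
jacobi-* : ∀ d m n .{{_ : ℕ.NonZero m}} .{{_ : ℕ.NonZero n}} → jacobi d (m ℕ.* n) ≡ jacobi d m * jacobi d n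
jacobi-* d m n = begin
  jacobi d (m ℕ.* n)    ≡⟨ jacobi-factors d {{ℕ.m*n≢0 m n}} fmn ⟩
  legendreProduct d (Fm.factors ++ Fn.factors) ≡⟨ legendreProduct-++ d Fm.factors Fn.factors ⟩
  legendreProduct d Fm.factors * legendreProduct d Fn.factors
                        ≡⟨ cong₂ _*_ (jacobi-factors d (factorise m)) (jacobi-factors d (factorise n)) ⟨
  jacobi d m * jacobi d n ∎
  where
  open ≡-Reasoning
  module Fm = PrimeFactorisation (factorise m)
  module Fn = PrimeFactorisation (factorise n)
  fmn : PrimeFactorisation (m ℕ.* n)
  fmn = record
    { factors = Fm.factors ++ Fn.factors
    ; isFactorisation = trans (cong₂ ℕ._*_ Fm.isFactorisation Fn.isFactorisation)
                              (sym (product-++ Fm.factors Fn.factors))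
    ; factorsPrime = All.++⁺ Fm.factorsPrime Fn.factorsPrime
    }

jacobi-prime : ∀ d {p} → Prime p → jacobi d p ≡ legendre d p
jacobi-prime d {p} p-prime = trans
  (jacobi-factors d {{prime⇒nonZero p-prime}} (record
    { factors = p ∷ [] ; isFactorisation = sym (ℕ.*-identityʳ p) ; factorsPrime = p-prime ∷ [] }))
  (ℤ.*-identityʳ _)

jacobi-prime-spec : ∀ d {p} → Prime p → ¬ + p ∣ᶻ d →
  (jacobi d p ≡ + 1 × ∃ λ s → + p ∣ᶻ s * s - d) ⊎
  (jacobi d p ≡ -[1+ 0 ] × ∀ t → ¬ + p ∣ᶻ t * t - d)
jacobi-prime-spec d {zero} p-prime = contradiction p-prime ¬prime[0]
jacobi-prime-spec d {suc zero} p-prime = contradiction p-prime ¬prime[1]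
jacobi-prime-spec d {suc (suc j)} p-prime p∤d rewrite jacobi-prime d p-prime = legendre₂₊-spec d j p∤d

IsSign : ℤ → Set
IsSign x = x ≡ + 1 ⊎ x ≡ -[1+ 0 ]

jacobi-prime-isSign : ∀ d {p} → Prime p → ¬ + p ∣ᶻ d → IsSign (jacobi d p)
jacobi-prime-isSign d p-prime p∤d = Sum.map proj₁ proj₁ (jacobi-prime-spec d p-prime p∤d)

*-isSign : ∀ {x y} → IsSign x → IsSign y → IsSign (x * y)
*-isSign (inj₁ refl) (inj₁ refl) = inj₁ refl
*-isSign (inj₁ refl) (inj₂ refl) = inj₂ refl
*-isSign (inj₂ refl) (inj₁ refl) = inj₂ refl
*-isSign (inj₂ refl) (inj₂ refl) = inj₁ refl

jacobi-isSign : ∀ d m .{{_ : ℕ.NonZero m}} → (∀ {p} → Prime p → p ∣ m → ¬ + p ∣ᶻ d) → IsSign (jacobi d m)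
jacobi-isSign d m p∤d = subst IsSign (sym (jacobi-factors d (factorise m)))
  (go factors factorsPrime λ p∈ → subst (_ ℕ.∣_) (sym isFactorisation) (∈⇒∣product p∈))
  where
  open PrimeFactorisation (factorise m)
  go : ∀ ps → All Prime ps → (∀ {p} → p ∈ ps → p ∣ m) → IsSign (legendreProduct d ps)
  go [] [] _ = inj₁ refl
  go (p ∷ ps) (p-prime ∷ primes) ps∣m = *-isSign
    (subst IsSign (jacobi-prime d p-prime)
      (jacobi-prime-isSign d p-prime (p∤d p-prime (ps∣m (here refl)))))
    (go ps primes (ps∣m ∘ there))

-- Common prime divisors, inverses modulo an integer, and parity.

prime-divisor : ∀ n .{{_ : ℕ.NonZero n}} → n ≢ 1 → ∃ λ p → Prime p × p ∣ n
prime-divisor n n≢1 = go factors isFactorisation factorsPrime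
  where
  open PrimeFactorisation (factorise n)
  go : ∀ ps → n ≡ product ps → All Prime ps → ∃ λ p → Prime p × p ∣ n
  go [] n≡1 _ = contradiction n≡1 n≢1
  go (p ∷ ps) n≡ (p-prime ∷ _) = p , p-prime , subst (p ℕ.∣_) (sym n≡) (∈⇒∣product {ns = p ∷ ps} (here refl))

noCommonPrime⇒gcd≡1 : ∀ m n .{{_ : ℕ.NonZero m}} → (∀ p → Prime p → p ∣ m → ¬ p ∣ n) → gcd m n ≡ 1
noCommonPrime⇒gcd≡1 m n disjoint with gcd m n ℕ.≟ 1
... | yes gcd≡1 = gcd≡1
... | no gcd≢1 with prime-divisor (gcd m n) {{ℕ.≢-nonZero (gcd[m,n]≢0 m n (inj₁ (ℕ.≢-nonZero⁻¹ m)))}} gcd≢1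
...   | p , p-prime , p∣gcd = contradiction (ℕ.∣-trans p∣gcd (gcd[m,n]∣n m n))
                                (disjoint p p-prime (ℕ.∣-trans p∣gcd (gcd[m,n]∣m m n)))

prime∣prime⇒≡ : ∀ {p q} → Prime p → Prime q → p ∣ q → p ≡ q
prime∣prime⇒≡ p-prime q-prime p∣q with prime⇒irreducible q-prime p∣q
... | inj₁ refl = contradiction p-prime ¬prime[1]
... | inj₂ p≡q = p≡q

gcd≡1⇒∤ : ∀ {n d p} → gcd n ℤ.∣ d ∣ ≡ 1 → Prime p → p ℕ.∣ n → ¬ + p ∣ᶻ d
gcd≡1⇒∤ n⊥d p-prime p∣n p∣d = ¬prime[1] (subst Prime (gcd≡1⇒coprime n⊥d (p∣n , ∣⇒∣ᵤ p∣d)) p-prime)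

inverse-mod : ∀ {m n} → Coprime m n → ∃ λ u → + m ∣ᶻ + n * u - + 1
inverse-mod {m} {n} coprime with coprime-Bézout coprime
... | Bézout.+- x y eq = - + y , divides (- + x) (trans (lemma₁ (+ n) (+ y))
        (trans (cong -_ (trans (cong (ℤ._+_ (+ 1)) (sym (ℤ.pos-* y n))) (trans (cong +_ eq) (ℤ.pos-* x m)))) (lemma₂ (+ x) (+ m))))
  where
  lemma₁ : ∀ n y → n * (- y) - + 1 ≡ - (+ 1 + y * n)
  lemma₁ = solve-∀
  lemma₂ : ∀ x m → - (x * m) ≡ - x * m
  lemma₂ = solve-∀
... | Bézout.-+ x y eq = + y , divides (+ x) (trans (lemma₁ (+ n) (+ y))
        (trans (cong (_- + 1) (trans (sym (trans (cong +_ eq) (ℤ.pos-* y n))) (cong (ℤ._+_ (+ 1)) (ℤ.pos-* x m)))) (lemma₂ (+ x * + m))))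
  where
  lemma₁ : ∀ n y → n * y - + 1 ≡ y * n - + 1
  lemma₁ = solve-∀
  lemma₂ : ∀ u → (+ 1 + u) - + 1 ≡ u
  lemma₂ = solve-∀

odd⇒1+2h : ∀ n → Odd n → ∃ λ h → n ≡ suc (h ℕ.+ h)
odd⇒1+2h n odd = n / 2 , trans (m≡m%n+[m/n]*n n 2) (cong₂ ℕ._+_ odd
  (trans (ℕ.*-comm (n / 2) 2) (cong (n / 2 ℕ.+_) (ℕ.+-identityʳ (n / 2)))))

1+2h⇒2∤ : ∀ {n} h → n ≡ suc (h ℕ.+ h) → ¬ 2 ∣ n
1+2h⇒2∤ h refl 2∣n = contradiction (ℕ.∣1⇒≡1 (ℕ.∣m+n∣m⇒∣n (subst (2 ℕ.∣_) (ℕ.+-comm 1 (h ℕ.+ h)) 2∣n) 2∣h+h)) λ ()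
  where
  2∣h+h : 2 ∣ h ℕ.+ h
  2∣h+h = ℕ.divides h (trans (cong (h ℕ.+_) (sym (ℕ.+-identityʳ h))) (ℕ.*-comm 2 h))

∣odd⇒odd : ∀ {m n} → m ∣ n → Odd n → Odd m
∣odd⇒odd {m} {n} m∣n odd = go (m % 2) refl (m%n<n m 2)
  where
  go : ∀ r → m % 2 ≡ r → r ℕ.< 2 → r ≡ 1
  go zero eq _ = contradiction (ℕ.∣-trans (ℕ.m%n≡0⇒n∣m m 2 eq) m∣n) (1+2h⇒2∤ (proj₁ (odd⇒1+2h n odd)) (proj₂ (odd⇒1+2h n odd)))
  go (suc zero) _ _ = refl
  go (suc (suc _)) _ (s≤s (s≤s ()))

-- Divisibility of n - δ_n by q - δ_q.

module Korselt {d a₁ b₁ : ℤ} (d≡ : d ≡ a₁ * a₁ - + 4 * b₁)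
  {n N q M : ℕ} (n≡q*M : n ≡ q ℕ.* M) (n-odd : Odd n) (n⊥d : gcd n ℤ.∣ d ∣ ≡ 1)
  (q-prime : Prime q) (q∤M : ¬ q ∣ M)
  (n∣U : ∀ a b → d ≡ a * a - + 4 * b → gcd n ℤ.∣ d * b ∣ ≡ 1 → + n ℤᵤ.∣ U a b N)
  where

  open Quadratic d

  q∣n : q ∣ n
  q∣n = ℕ.divides M (trans n≡q*M (ℕ.*-comm q M))

  ∣n⇒∤d : ∀ {p} → Prime p → p ∣ n → ¬ + p ∣ᶻ d
  ∣n⇒∤d = gcd≡1⇒∤ n⊥d

  k h : ℕ
  k = proj₁ (odd⇒1+2h n n-odd)
  h = proj₁ (odd⇒1+2h q (∣odd⇒odd q∣n n-odd))

  n≡1+2k : n ≡ suc (k ℕ.+ k)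
  n≡1+2k = proj₂ (odd⇒1+2h n n-odd)

  q≡1+2h : q ≡ suc (h ℕ.+ h)
  q≡1+2h = proj₂ (odd⇒1+2h q (∣odd⇒odd q∣n n-odd))

  q⊥M : Coprime q M
  q⊥M {i} (i∣q , i∣M) with prime⇒irreducible q-prime i∣q
  ... | inj₁ i≡1 = i≡1
  ... | inj₂ refl = contradiction i∣M q∤M

  module _ (t : ℤ) (q∤N : ¬ + q ∣ᶻ t * t - d) where

    -- a is congruent to t modulo q, to 0 modulo M and to a₁ modulo 2; since a ≡ 0 modulo M,
    -- 4 b = a² - d ≡ - d is prime to M.
    u : ℤ
    u = proj₁ (inverse-mod q⊥M)

    a₀ w a b : ℤ
    a₀ = + M * (u * t)
    w = + k * (a₁ - a₀)
    a = a₁ + + 2 * w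
    b = b₁ + a₁ * w + w * w

    d≡a²-4b : d ≡ a * a - + 4 * b
    d≡a²-4b = trans d≡ (lemma a₁ b₁ w)
      where
      lemma : ∀ a b w → a * a - + 4 * b ≡ (a + + 2 * w) * (a + + 2 * w) - + 4 * (b + a * w + w * w)
      lemma = solve-∀

    -- As n = 2k + 1, adding 2k (a₁ - a₀) to a₁ is adding n (a₁ - a₀) to a₀. So `a` has the residue
    -- of a₀ modulo n and the parity of a₁, and the latter makes `b` an integer.
    a≡ : a ≡ a₀ + + q * + M * (a₁ - a₀)
    a≡ = trans (lemma a₀ a₁ (+ k)) (cong (λ x → a₀ + x * (a₁ - a₀))
      (trans (sym (cong +_ n≡1+2k)) (trans (cong +_ n≡q*M) (ℤ.pos-* q M))))
      where
      lemma : ∀ a₀ a₁ k → a₁ + + 2 * (k * (a₁ - a₀)) ≡ a₀ + (+ 1 + (k + k)) * (a₁ - a₀)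
      lemma = solve-∀

    M∣a : + M ∣ᶻ a
    M∣a = ∣-resp (sym a≡) (∣m∣n⇒∣m+n (∣m⇒∣m*n (u * t) ∣-refl) (∣m⇒∣m*n (a₁ - a₀) (∣n⇒∣m*n (+ q) ∣-refl)))

    q∣a-t : + q ∣ᶻ a - t
    q∣a-t = ∣-resp (sym (trans (cong (_- t) a≡) (lemma (+ q) (+ M) u t (a₁ - a₀))))
      (∣m∣n⇒∣m+n (∣m⇒∣m*n t (proj₂ (inverse-mod q⊥M))) (∣m⇒∣m*n (+ M * (a₁ - a₀)) ∣-refl))
      where
      lemma : ∀ q M u t x → (M * (u * t) + q * M * x) - t ≡ (M * u - + 1) * t + q * (M * x)
      lemma = solve-∀

    -- A prime p dividing n does not divide d. If it divided b, it would divide a² - d: for p = q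
    -- this contradicts a ≡ t, and for p dividing M, where a ≡ 0, it would give p ∣ d.
    n⊥db : gcd n ℤ.∣ d * b ∣ ≡ 1
    n⊥db = noCommonPrime⇒gcd≡1 n ℤ.∣ d * b ∣ {{n≢0}} disjoint
      where
      n≢0 : ℕ.NonZero n
      n≢0 = ℕ.≢-nonZero (λ n≡0 → contradiction (trans (sym n≡1+2k) n≡0) λ ())
      ∣b⇒∣a²-d : ∀ {i} → i ∣ᶻ b → i ∣ᶻ a * a - d
      ∣b⇒∣a²-d i∣b = ∣-resp (trans (lemma a b) (cong (λ x → a * a - x) (sym d≡a²-4b))) (∣n⇒∣m*n (+ 4) i∣b)
        where
        lemma : ∀ a b → + 4 * b ≡ a * a - (a * a - + 4 * b)
        lemma = solve-∀
      q∤b : ¬ + q ∣ᶻ b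
      q∤b q∣b = q∤N (∣-resp (lemma a t d) (∣m∣n⇒∣m-n (∣b⇒∣a²-d q∣b) (∣m⇒∣m*n (a + t) q∣a-t)))
        where
        lemma : ∀ a t d → (a * a - d) - (a - t) * (a + t) ≡ t * t - d
        lemma = solve-∀
      disjoint : ∀ p → Prime p → p ℕ.∣ n → ¬ p ℕ.∣ ℤ.∣ d * b ∣
      disjoint p p-prime p∣n p∣db =
        [ ∣n⇒∤d p-prime p∣n , [ p∣q⇒ , p∣M⇒ ]′ (euclidsLemma′ (subst (p ℕ.∣_) n≡q*M p∣n)) ]′
          (euclidsLemmaℤ p-prime d b (∣ᵤ⇒∣ p∣db))
        where
        euclidsLemma′ = euclidsLemma q M p-prime
        p∣q⇒ : p ∣ q → ¬ + p ∣ᶻ b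
        p∣q⇒ p∣q p∣b = q∤b (subst (λ i → + i ∣ᶻ b) (prime∣prime⇒≡ p-prime q-prime p∣q) p∣b)
        p∣M⇒ : p ∣ M → ¬ + p ∣ᶻ b
        p∣M⇒ p∣M p∣b = ∣n⇒∤d p-prime p∣n (∣-resp (lemma a d)
          (∣m∣n⇒∣m-n (∣m⇒∣m*n a (∣-trans (∣ᵤ⇒∣ p∣M) M∣a)) (∣b⇒∣a²-d p∣b)))
          where
          lemma : ∀ a d → a * a - (a * a - d) ≡ d
          lemma = solve-∀

    q∣2^*⇒ : ∀ x → + q ∣ᶻ + 2 * x → + q ∣ᶻ x
    q∣2^*⇒ x = prime-cancelˡ q-prime (+ 2) x (λ q∣2 → 1+2h⇒2∤ h q≡1+2h
      (ℕ.∣-reflexive (sym (prime∣prime⇒≡ q-prime prime[2] (∣⇒∣ᵤ q∣2)))))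

    q∣B : + q ∣ᶻ B N t
    q∣B = ∣-resp (lemma (B N a) (B N t))
      -- In 2^N U_N = 2 B_N the power of 2 stands beside `U`, so a single factor 2 has to be
      -- cancelled, and q is odd.
      (∣m∣n⇒∣m-n (q∣2^*⇒ (B N a) (∣-resp (U-B a b d≡a²-4b N) (∣n⇒∣m*n ((+ 2) ^ N) q∣U)))
        (∣-trans q∣a-t (proj₂ (B-congruence d N a t))))
      where
      q∣U : + q ∣ᶻ U a b N
      q∣U = ∣ᵤ⇒∣ (ℕ.∣-trans q∣n (n∣U a b d≡a²-4b n⊥db))
      lemma : ∀ x y → x - (x - y) ≡ y
      lemma = solve-∀

  -- The value 1 of δ_q supplies a square root of d modulo q and leads to q - 1; the value -1
  -- excludes all roots and leads to q + 1.
  q-δ∣N : ℤ.∣ + q - δ d q ∣ ℕ.∣ N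
  q-δ∣N = [ split , inert ]′ (jacobi-prime-spec d q-prime q∤d)
    where
    q∤d = ∣n⇒∤d q-prime q∣n
    open OddPrime d {h = h} q-prime q≡1+2h q∤d using (split⇒p-1∣; inert⇒p+1∣)
    split : δ d q ≡ + 1 × (∃ λ s → + q ∣ᶻ s * s - d) → ℤ.∣ + q - δ d q ∣ ℕ.∣ N
    split (δ≡1 , s , q∣) = subst (ℕ._∣ N) (sym (cong₂ (λ x y → ℤ.∣ + x - y ∣) q≡1+2h δ≡1))
      (split⇒p-1∣ s q∣ N q∣B)
    inert : δ d q ≡ -[1+ 0 ] × (∀ t → ¬ + q ∣ᶻ t * t - d) → ℤ.∣ + q - δ d q ∣ ℕ.∣ N
    inert (δ≡-1 , q∤) = subst (ℕ._∣ N) (sym (trans (cong (λ y → ℤ.∣ + q - y ∣) δ≡-1) (ℕ.+-comm q 1)))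
      (inert⇒p+1∣ q∤ N q∣B)

-- Estimates for C and D

infix 4 0≤_ 0<_
-- Inequalities are phrased as the sign of one expression, so that an estimate becomes an identity
-- writing this expression as a sum of visibly nonnegative terms and a positive one.
0≤_ 0<_ : ℤ → Set
0≤ x = + 0 ℤ.≤ x
0< x = + 0 ℤ.< x

0≤-+ : ∀ {x y} → 0≤ x → 0≤ y → 0≤ x + y
0≤-+ = ℤ.+-mono-≤

0≤+0< : ∀ {x y} → 0≤ x → 0< y → 0< x + y
0≤+0< = ℤ.+-mono-≤-<

0≤-* : ∀ {x y} → 0≤ x → 0≤ y → 0≤ x * y
0≤-* {x} {y} 0≤x 0≤y = subst (ℤ._≤ x * y) (ℤ.*-zeroʳ x)
  (ℤ.*-monoˡ-≤-nonNeg x {{ℤ.nonNegative 0≤x}} 0≤y)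

0<-* : ∀ {x y} → 0< x → 0< y → 0< x * y
0<-* {x} {y} 0<x 0<y = subst (ℤ._< x * y) (ℤ.*-zeroʳ x)
  (ℤ.*-monoˡ-<-pos x {{ℤ.positive 0<x}} 0<y)

0<-factor : ∀ {x y} → 0< y → 0< x * y → 0< x
0<-factor {x} {y} 0<y 0<xy = ℤ.*-cancelʳ-<-nonNeg y {{ℤ.nonNegative (ℤ.<⇒≤ 0<y)}}
  (subst (ℤ._< x * y) (sym (ℤ.*-zeroˡ y)) 0<xy)

0<-⇒< : ∀ {x y} → 0< y - x → x ℤ.< y
0<-⇒< {x} {y} 0<y-x = subst₂ ℤ._<_ (ℤ.+-identityʳ x) (lemma x y) (ℤ.+-monoʳ-< x 0<y-x)
  where
  lemma : ∀ x y → x + (y - x) ≡ y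
  lemma = solve-∀

sign-square : ∀ {s} → IsSign s → s * s ≡ + 1
sign-square (inj₁ refl) = refl
sign-square (inj₂ refl) = refl

0≤1-sign : ∀ {s} → IsSign s → 0≤ + 1 - s
0≤1-sign (inj₁ refl) = ℤ.+≤+ z≤n
0≤1-sign (inj₂ refl) = ℤ.+≤+ z≤n

0≤1+sign : ∀ {s} → IsSign s → 0≤ + 1 + s
0≤1+sign (inj₁ refl) = ℤ.+≤+ z≤n
0≤1+sign (inj₂ refl) = ℤ.+≤+ z≤n

-- Modulo q - f one has q ≡ f, so P q r - e f g ≡ f (P r - e g), and f is its own inverse.
sign-quotient : ∀ {P q r e f g} → IsSign f → (q - f) ∣ᶻ (P * q * r - e * f * g) →
                ∃ λ C → P * r - e * g ≡ C * (q - f)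
sign-quotient {P} {q} {r} {e} {f} {g} f-sign (divides k eq) = f * (k - P * r) , (begin
  P * r - e * g                    ≡⟨ ℤ.*-identityˡ (P * r - e * g) ⟨
  + 1 * (P * r - e * g)            ≡⟨ cong (_* (P * r - e * g)) (sign-square f-sign) ⟨
  f * f * (P * r - e * g)          ≡⟨ lemma₁ P q r e f g ⟩
  f * ((P * q * r - e * f * g) - P * r * (q - f)) ≡⟨ cong (λ x → f * (x - P * r * (q - f))) eq ⟩
  f * (k * (q - f) - P * r * (q - f)) ≡⟨ lemma₂ f k (P * r) (q - f) ⟩
  f * (k - P * r) * (q - f)         ∎)
  where
  open ≡-Reasoning
  lemma₁ : ∀ P q r e f g → f * f * (P * r - e * g) ≡ f * ((P * q * r - e * f * g) - P * r * (q - f))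
  lemma₁ = solve-∀
  lemma₂ : ∀ f k x y → f * (k * y - x * y) ≡ f * (k - x) * y
  lemma₂ = solve-∀

-- The sign of Δ is unknown: if Δ ≥ 0 then a Δ ≤ Q Δ < X, and if Δ ≤ 0 then already a Δ ≤ 0 < X.
0<-shrink : ∀ {X Q a Δ} → 0< X → 0≤ a → 0≤ Q - a → 0< X - Q * Δ → 0< X - a * Δ
0<-shrink {X} {Q} {a} {Δ} 0<X 0≤a a≤Q 0<X-QΔ with ℤ.≤-total (+ 0) Δ
... | inj₁ 0≤Δ = subst 0<_ (lemma X Q a Δ) (0≤+0< (0≤-* a≤Q 0≤Δ) 0<X-QΔ)
  where
  lemma : ∀ X Q a D → (Q - a) * D + (X - Q * D) ≡ X - a * D
  lemma = solve-∀
... | inj₂ Δ≤0 = subst 0<_ (lemma X a Δ) (0≤+0< (0≤-* 0≤a (ℤ.i≤j⇒0≤j-i Δ≤0)) 0<X)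
  where
  lemma : ∀ X a D → a * (+ 0 - D) + X ≡ X - a * D
  lemma = solve-∀

-- Here e, f, g stand for δ_P, δ_q, δ_r. The gaps of 2 between p, q and r leave room for these
-- signs.
module Bounds {P q r p e f g C D : ℤ} (e-sign : IsSign e) (f-sign : IsSign f) (g-sign : IsSign g)
  (2≤P : 0≤ P - + 2) (0≤p : 0≤ p) (p+2≤q : 0≤ q - (p + + 2)) (q+2≤r : 0≤ r - (q + + 2))
  (C-eq : P * r - e * g ≡ C * (q - f)) (D-eq : P * q - e * f ≡ D * (r - g)) where

  0<P : 0< P
  0<P = subst 0<_ (lemma P) (0≤+0< 2≤P (ℤ.+<+ (s≤s z≤n)))
    where
    lemma : ∀ P → P - + 2 + + 2 ≡ P
    lemma = solve-∀

  0≤P : 0≤ P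
  0≤P = ℤ.<⇒≤ 0<P

  0<P-sign : ∀ {s} → IsSign s → 0< P - s
  0<P-sign {s} s-sign = subst 0<_ (lemma P s) (0≤+0< (0≤-+ 2≤P (0≤1-sign s-sign)) (ℤ.+<+ (s≤s z≤n)))
    where
    lemma : ∀ P s → P - + 2 + (+ 1 - s) + + 1 ≡ P - s
    lemma = solve-∀

  0<P+sign : ∀ {s} → IsSign s → 0< P + s
  0<P+sign {s} s-sign = subst 0<_ (lemma P s) (0≤+0< (0≤-+ 2≤P (0≤1+sign s-sign)) (ℤ.+<+ (s≤s z≤n)))
    where
    lemma : ∀ P s → P - + 2 + (+ 1 + s) + + 1 ≡ P + s
    lemma = solve-∀

  0≤p+1 : 0≤ p + + 1
  0≤p+1 = 0≤-+ 0≤p (ℤ.+≤+ z≤n)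

  p+1≤q-f : 0≤ (q - f) - (p + + 1)
  p+1≤q-f = subst 0≤_ (lemma p q f) (0≤-+ p+2≤q (0≤1-sign f-sign))
    where
    lemma : ∀ p q f → q - (p + + 2) + (+ 1 - f) ≡ (q - f) - (p + + 1)
    lemma = solve-∀

  0≤q-1 : 0≤ q - + 1
  0≤q-1 = subst 0≤_ (lemma p q) (0≤-+ p+2≤q 0≤p+1)
    where
    lemma : ∀ p q → q - (p + + 2) + (p + + 1) ≡ q - + 1
    lemma = solve-∀

  0<q-f : 0< q - f
  0<q-f = subst 0<_ (lemma p q f) (0≤+0< (0≤-+ p+1≤q-f 0≤p) (ℤ.+<+ (s≤s z≤n)))
    where
    lemma : ∀ p q f → (q - f) - (p + + 1) + p + + 1 ≡ q - f
    lemma = solve-∀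

  0<r-g : 0< r - g
  0<r-g = subst 0<_ (lemma q r g) (0≤+0< (0≤-+ (0≤-+ q+2≤r 0≤q-1) (0≤1-sign g-sign)) (ℤ.+<+ (s≤s z≤n)))
    where
    lemma : ∀ q r g → r - (q + + 2) + (q - + 1) + (+ 1 - g) + + 2 ≡ r - g
    lemma = solve-∀

  0<D : 0< D
  0<D = 0<-factor 0<r-g (subst 0<_ (trans (lemma P q (e * f)) D-eq)
    (0≤+0< (0≤-* 0≤P 0≤q-1) (0<P-sign (*-isSign e-sign f-sign))))
    where
    lemma : ∀ P q s → P * (q - + 1) + (P - s) ≡ P * q - s
    lemma = solve-∀

  -- Since r - g ≥ q + 1 and P > 1, the product P (r - g) exceeds P q - e f = D (r - g).
  0<P-D : 0< P - D
  0<P-D = 0<-factor 0<r-g (subst 0<_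
    (trans (lemma₁ P q r (e * f) g) (trans (cong (λ x → P * (r - g) - x) D-eq) (lemma₂ P D (r - g))))
    (0≤+0< (0≤-+ (0≤-* 0≤P q+2≤r) (0≤-* 0≤P (0≤1-sign g-sign))) (0<P+sign (*-isSign e-sign f-sign))))
    where
    lemma₁ : ∀ P q r s g → P * (r - (q + + 2)) + P * (+ 1 - g) + (P + s) ≡ P * (r - g) - (P * q - s)
    lemma₁ = solve-∀
    lemma₂ : ∀ P D R → P * R - D * R ≡ (P - D) * R
    lemma₂ = solve-∀

  -- Since q - f ≤ r - 1 and P > 1, the product P (q - f) stays below P r - e g = C (q - f).
  0<C-P : 0< C - P
  0<C-P = 0<-factor 0<q-f (subst 0<_
    (trans (lemma₁ P q r (e * g) f) (trans (cong (λ x → x - P * (q - f)) C-eq) (lemma₂ P C (q - f))))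
    (0≤+0< (0≤-+ (0≤-* 0≤P q+2≤r) (0≤-* 0≤P (0≤1+sign f-sign))) (0<P-sign (*-isSign e-sign g-sign))))
    where
    lemma₁ : ∀ P q r s f → P * (r - (q + + 2)) + P * (+ 1 + f) + (P - s) ≡ (P * r - s) - P * (q - f)
    lemma₁ = solve-∀
    lemma₂ : ∀ P C Q → C * Q - P * Q ≡ (C - P) * Q
    lemma₂ = solve-∀

  Δ : ℤ
  Δ = C * D - P * P

  -- Replacing C (q - f) by P r - e g and then D (r - g) by P q - e f eliminates r, and the terms P²
  -- q cancel.
  Δ[q-f] : Δ * (q - f) ≡ (P - e) * (f * P + g * D)
  Δ[q-f] = trans (lemma₁ C D P (q - f)) (trans (cong (λ x → D * x - P * P * (q - f)) (sym C-eq))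
    (trans (lemma₂ P q r e f g D) (trans (cong (λ x → P * x + D * (g * (P - e)) - P * (P * q) + P * P * f) (sym D-eq))
      (lemma₃ P q e f g D))))
    where
    lemma₁ : ∀ C D P Q → (C * D - P * P) * Q ≡ D * (C * Q) - P * P * Q
    lemma₁ = solve-∀
    lemma₂ : ∀ P q r e f g D → D * (P * r - e * g) - P * P * (q - f) ≡
             P * (D * (r - g)) + D * (g * (P - e)) - P * (P * q) + P * P * f
    lemma₂ = solve-∀
    lemma₃ : ∀ P q e f g D → P * (P * q - e * f) + D * (g * (P - e)) - P * (P * q) + P * P * f ≡
             (P - e) * (f * P + g * D)
    lemma₃ = solve-∀

  Δ[r-g] : Δ * (r - g) ≡ (P - e) * (g * P + f * C)
  Δ[r-g] = trans (lemma₁ C D P (r - g)) (trans (cong (λ x → C * x - P * P * (r - g)) (sym D-eq))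
    (trans (lemma₂ P q r e f g C) (trans (cong (λ x → P * x + C * (f * (P - e)) - P * (P * r) + P * P * g) (sym C-eq))
      (lemma₃ P r e f g C))))
    where
    lemma₁ : ∀ C D P R → (C * D - P * P) * R ≡ C * (D * R) - P * P * R
    lemma₁ = solve-∀
    lemma₂ : ∀ P q r e f g C → C * (P * q - e * f) - P * P * (r - g) ≡
             P * (C * (q - f)) + C * (f * (P - e)) - P * (P * r) + P * P * g
    lemma₂ = solve-∀
    lemma₃ : ∀ P r e f g C → P * (P * r - e * g) + C * (f * (P - e)) - P * (P * r) + P * P * g ≡
             (P - e) * (g * P + f * C)
    lemma₃ = solve-∀

  -- For Δ = 0, multiplying `Δ[q-f]` by f would give (P - e) (P + f g D) = 0, while P > e and P + f
  -- g D ≥ P - D > 0. This legitimises the division by Δ.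
  Δ≢0 : Δ ≢ + 0
  Δ≢0 Δ≡0 = ℤ.<-irrefl refl (subst 0<_ vanish
    (0<-* (0<P-sign e-sign) (0≤+0< (0≤-* (ℤ.<⇒≤ 0<D) (0≤1+sign (*-isSign f-sign g-sign))) 0<P-D)))
    where
    lemma₁ : ∀ P D e s → (P - e) * (D * (+ 1 + s) + (P - D)) ≡ (P - e) * (+ 1 * P + s * D)
    lemma₁ = solve-∀
    lemma₂ : ∀ P D e f g → (P - e) * (f * f * P + f * g * D) ≡ f * ((P - e) * (f * P + g * D))
    lemma₂ = solve-∀
    vanish : (P - e) * (D * (+ 1 + f * g) + (P - D)) ≡ + 0
    vanish = trans (lemma₁ P D e (f * g))
      (trans (cong (λ x → (P - e) * (x * P + f * g * D)) (sym (sign-square f-sign)))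
      (trans (lemma₂ P D e f g)
      (trans (cong (f *_) (trans (sym Δ[q-f]) (trans (cong (_* (q - f)) Δ≡0) (ℤ.*-zeroˡ (q - f))))) (ℤ.*-zeroʳ f))))

  -- A strict bound for |Δ| (q - f), because P - e ≤ P + 1 and |f P + g D| < 2 P.
  X : ℤ
  X = + 2 * P * (P + + 1)

  0≤2P[1+e] : 0≤ + 2 * P * (+ 1 + e)
  0≤2P[1+e] = 0≤-* {+ 2 * P} (0≤-* {+ 2} (ℤ.+≤+ z≤n) 0≤P) (0≤1+sign e-sign)

  0<X : 0< X
  0<X = 0<-* {+ 2 * P} (0<-* {+ 2} (ℤ.+<+ (s≤s z≤n)) 0<P) (0<P+sign (inj₁ refl))

  [p+1]Δ<X : 0< X - (p + + 1) * Δ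
  [p+1]Δ<X = 0<-shrink {Q = q - f} 0<X 0≤p+1 p+1≤q-f
    -- The slack is split by 2 P (P + 1) = 2 P (1 + e) + 2 P (P - e) and 2 P - f P - g D = P (1 - f)
    -- + D (1 - g) + (P - D).
    (subst 0<_ (trans (lemma P D e f g) (cong (λ x → X - x) (trans (sym Δ[q-f]) (ℤ.*-comm Δ (q - f)))))
      (0≤+0< 0≤2P[1+e] (0<-* (0<P-sign e-sign)
        (0≤+0< (0≤-+ (0≤-* 0≤P (0≤1-sign f-sign)) (0≤-* (ℤ.<⇒≤ 0<D) (0≤1-sign g-sign))) 0<P-D))))
    where
    lemma : ∀ P D e f g → + 2 * P * (+ 1 + e) + (P - e) * (P * (+ 1 - f) + D * (+ 1 - g) + (P - D)) ≡
            + 2 * P * (P + + 1) - (P - e) * (f * P + g * D)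
    lemma = solve-∀

  -- The splitting is that of `[p+1]Δ<X` with f and g replaced by their negatives.
  -X<[p+1]Δ : 0< X - (p + + 1) * (- Δ)
  -X<[p+1]Δ = 0<-shrink {Q = q - f} 0<X 0≤p+1 p+1≤q-f
    (subst 0<_ (trans (lemma P D e f g) (trans (cong (λ x → X - - x) (sym Δ[q-f])) (lemma′ X Δ (q - f))))
      (0≤+0< 0≤2P[1+e] (0<-* (0<P-sign e-sign)
        (0≤+0< (0≤-+ (0≤-* 0≤P (0≤1+sign f-sign)) (0≤-* (ℤ.<⇒≤ 0<D) (0≤1+sign g-sign))) 0<P-D))))
    where
    lemma : ∀ P D e f g → + 2 * P * (+ 1 + e) + (P - e) * (P * (+ 1 + f) + D * (+ 1 + g) + (P - D)) ≡
            + 2 * P * (P + + 1) - - ((P - e) * (f * P + g * D))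
    lemma = solve-∀
    lemma′ : ∀ X D Q → X - - (D * Q) ≡ X - Q * (- D)
    lemma′ = solve-∀

  -- (p + 1) C D is (p + 1) P² + (p + 1) Δ, where the last term exceeds -2 P (P + 1); collecting the
  -- multiples of P² gives p - 1. The upper bound arises in the same way.
  lower : (p - + 1) * (P * P) - + 2 * P ℤ.< (p + + 1) * (C * D)
  lower = 0<-⇒< (subst 0<_ (lemma P p (C * D)) -X<[p+1]Δ)
    where
    lemma : ∀ P p x → + 2 * P * (P + + 1) - (p + + 1) * (- (x - P * P)) ≡
            (p + + 1) * x - ((p - + 1) * (P * P) - + 2 * P)
    lemma = solve-∀

  upper : (p + + 1) * (C * D) ℤ.< (p + + 3) * (P * P) + + 2 * P
  upper = 0<-⇒< (subst 0<_ (lemma P p (C * D)) [p+1]Δ<X)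
    where
    lemma : ∀ P p x → + 2 * P * (P + + 1) - (p + + 1) * (x - P * P) ≡
            (p + + 3) * (P * P) + + 2 * P - (p + + 1) * x
    lemma = solve-∀

-- Gaps between odd numbers, and the derivation of the identities and bounds for n = P q r.

odd-gap : ∀ {m n} → Odd m → Odd n → m ℕ.< n → m ℕ.+ 2 ℕ.≤ n
odd-gap {m} {n} m-odd n-odd m<n with ℕ.m≤n⇒m<n∨m≡n m<n
... | inj₁ m+1<n = subst (ℕ._≤ n) (ℕ.+-comm 2 m) m+1<n
... | inj₂ refl = contradiction (2∣ (odd⇒1+2h m m-odd))
                    (1+2h⇒2∤ (proj₁ (odd⇒1+2h (suc m) n-odd)) (proj₂ (odd⇒1+2h (suc m) n-odd)))
  where
  2∣ : (∃ λ h → m ≡ suc (h ℕ.+ h)) → 2 ∣ suc m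
  2∣ (h , refl) = ℕ.divides (suc h) (cong (2 ℕ.+_)
    (trans (cong (h ℕ.+_) (sym (ℕ.+-identityʳ h))) (ℕ.*-comm 2 h)))

korselt : ∀ {d n} → AdmissibleDisc d → AbsLucasPsp d n → ∀ {q M} → n ≡ q ℕ.* M → Prime q → ¬ q ∣ M →
          (+ q ℤ.- δ d q) ∣ᶻ (+ n ℤ.- δ d n)
korselt {d} {n} (a₁ , b₁ , _ , _ , d≡) (n-odd , _ , n⊥d , n∣U) n≡q*M q-prime q∤M =
  ∣ᵤ⇒∣ (Korselt.q-δ∣N {d} {a₁} {b₁} d≡ n≡q*M n-odd n⊥d q-prime q∤M n∣U)

theorem4 : (d : ℤ) → AdmissibleDisc d →
    (n P q r p : ℕ) → AbsLucasPsp d n → n ≡ P ℕ.* q ℕ.* r →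
    Prime q → Prime r → q ℕ.< r → 1 ℕ.< P →
    (∀ s → Prime s → s ∣ P → s ℕ.< q) →
    Prime p → p ∣ P → (∀ s → Prime s → s ∣ P → s ℕ.≤ p) →
    ∃ λ (C : ℤ) → ∃ λ (D : ℤ) →
      let Pz = + P
          Δ = C ℤ.* D ℤ.- Pz ℤ.* Pz
          dP = δ d P
          dq = δ d q
          dr = δ d r
      in (+ 1 ℤ.≤ D) × (D ℤ.< Pz) × (Pz ℤ.< C) × (Δ ≢ + 0) ×
         (Δ ℤ.* (+ q ℤ.- dq) ≡ (Pz ℤ.- dP) ℤ.* (dq ℤ.* Pz ℤ.+ dr ℤ.* D)) ×
         (Δ ℤ.* (+ r ℤ.- dr) ≡ (Pz ℤ.- dP) ℤ.* (dr ℤ.* Pz ℤ.+ dq ℤ.* C)) ×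
         ((+ p ℤ.- + 1) ℤ.* (Pz ℤ.* Pz) ℤ.- + 2 ℤ.* Pz
            ℤ.< (+ p ℤ.+ + 1) ℤ.* (C ℤ.* D)) ×
         ((+ p ℤ.+ + 1) ℤ.* (C ℤ.* D)
            ℤ.< (+ p ℤ.+ + 3) ℤ.* (Pz ℤ.* Pz) ℤ.+ + 2 ℤ.* Pz)
theorem4 d d-adm n P q r p psp@(n-odd , _ , n⊥d , _) n≡Pqr q-prime r-prime q<r 1<P P<q p-prime p∣P _ =
  -- Fractions are cleared: the identities are multiplied by Δ, shown to be nonzero, and the bounds
  -- by p + 1.
  C , D , ℤ.i<j⇒suc[i]≤j 0<D , 0<-⇒< 0<P-D , 0<-⇒< 0<C-P , Δ≢0 , Δ[q-f] , Δ[r-g] , lower , upper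
  where
  instance
    P≢0 = ℕ.>-nonZero (ℕ.<-trans (s≤s z≤n) 1<P)
    q≢0 = prime⇒nonZero q-prime
    r≢0 = prime⇒nonZero r-prime

  P∣n : P ∣ n
  P∣n = ℕ.divides (q ℕ.* r) (trans n≡Pqr (trans (ℕ.*-assoc P q r) (ℕ.*-comm P (q ℕ.* r))))
  r∣n : r ∣ n
  r∣n = ℕ.divides (P ℕ.* q) n≡Pqr
  n≡q*Pr : n ≡ q ℕ.* (P ℕ.* r)
  n≡q*Pr = trans n≡Pqr (trans (cong (ℕ._* r) (ℕ.*-comm P q)) (ℕ.*-assoc q P r))
  n≡r*Pq : n ≡ r ℕ.* (P ℕ.* q)
  n≡r*Pq = trans n≡Pqr (ℕ.*-comm (P ℕ.* q) r)
  q∣n : q ∣ n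
  q∣n = ℕ.divides (P ℕ.* r) (trans n≡q*Pr (ℕ.*-comm q (P ℕ.* r)))

  -- The primes of P lie below q, and q < r, so q and r each divide n exactly once.
  q∤Pr : ¬ q ∣ P ℕ.* r
  q∤Pr q∣ with euclidsLemma P r q-prime q∣
  ... | inj₁ q∣P = ℕ.<-irrefl refl (P<q q q-prime q∣P)
  ... | inj₂ q∣r = ℕ.<⇒≢ q<r (prime∣prime⇒≡ q-prime r-prime q∣r)

  r∤Pq : ¬ r ∣ P ℕ.* q
  r∤Pq r∣ with euclidsLemma P q r-prime r∣
  ... | inj₁ r∣P = ℕ.<-asym q<r (P<q r r-prime r∣P)
  ... | inj₂ r∣q = ℕ.<⇒≢ q<r (sym (prime∣prime⇒≡ r-prime q-prime r∣q))

  e f g : ℤ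
  e = δ d P
  f = δ d q
  g = δ d r

  e-sign : IsSign e
  e-sign = jacobi-isSign d P (λ s-prime s∣P → gcd≡1⇒∤ n⊥d s-prime (ℕ.∣-trans s∣P P∣n))
  f-sign : IsSign f
  f-sign = jacobi-prime-isSign d q-prime (gcd≡1⇒∤ n⊥d q-prime q∣n)
  g-sign : IsSign g
  g-sign = jacobi-prime-isSign d r-prime (gcd≡1⇒∤ n⊥d r-prime r∣n)

  n-δ≡ : + n ℤ.- δ d n ≡ + P ℤ.* + q ℤ.* + r ℤ.- e ℤ.* f ℤ.* g
  n-δ≡ = cong₂ ℤ._-_
    (trans (cong +_ n≡Pqr) (trans (ℤ.pos-* (P ℕ.* q) r) (cong (ℤ._* + r) (ℤ.pos-* P q))))
    (trans (cong (δ d) n≡Pqr) (trans (jacobi-* d (P ℕ.* q) r {{ℕ.m*n≢0 P q}}) (cong (ℤ._* g) (jacobi-* d P q))))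

  C-quotient : ∃ λ C → + P ℤ.* + r ℤ.- e ℤ.* g ≡ C ℤ.* (+ q ℤ.- f)
  C-quotient = sign-quotient {+ P} {+ q} {+ r} {e} {f} {g} f-sign
    (∣-resp n-δ≡ (korselt d-adm psp n≡q*Pr q-prime q∤Pr))
  D-quotient : ∃ λ D → + P ℤ.* + q ℤ.- e ℤ.* f ≡ D ℤ.* (+ r ℤ.- g)
  -- The roles of q and r are exchanged.
  D-quotient = sign-quotient {+ P} {+ r} {+ q} {e} {g} {f} g-sign
    (∣-resp (trans n-δ≡ (lemma (+ P) (+ q) (+ r) e f g)) (korselt d-adm psp n≡r*Pq r-prime r∤Pq))
    where
    lemma : ∀ P q r e f g → P ℤ.* q ℤ.* r ℤ.- e ℤ.* f ℤ.* g ≡ P ℤ.* r ℤ.* q ℤ.- e ℤ.* g ℤ.* f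
    lemma = solve-∀

  C D : ℤ
  C = proj₁ C-quotient
  D = proj₁ D-quotient

  -- As divisors of the odd number n, p < q < r are all odd, hence at least 2 apart.
  p-odd = ∣odd⇒odd (ℕ.∣-trans p∣P P∣n) n-odd
  q-odd = ∣odd⇒odd q∣n n-odd
  r-odd = ∣odd⇒odd r∣n n-odd

  open Bounds {+ P} {+ q} {+ r} {+ p} {e} {f} {g} {C} {D} e-sign f-sign g-sign
    (ℤ.i≤j⇒0≤j-i (ℤ.+≤+ 1<P)) (ℤ.+≤+ z≤n)
    (ℤ.i≤j⇒0≤j-i (ℤ.+≤+ (odd-gap p-odd q-odd (P<q p p-prime p∣P))))
    (ℤ.i≤j⇒0≤j-i (ℤ.+≤+ (odd-gap q-odd r-odd q<r)))
    (proj₂ C-quotient) (proj₂ D-quotient)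
    using (0<D; 0<P-D; 0<C-P; Δ≢0; Δ[q-f]; Δ[r-g]; lower; upper)
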